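{- Fix any distribution of online vertices (types $I$ with type probabilities $\lambda_i/\Lambda$, offline vertices $J$, and weights $w_{ij}$) and any positive integer $\Lambda$. Then: 1. For any monotone online algorithm, its objective in online stochastic matching is at least its objective in the Poisson arrival model. 2. For any $\alpha>0$ and any $\alpha$-approximately monotone online algorithm, its objective in online stochastic matching is at least $1 - O(\alpha\Lambda^{ -1/2})$ times its objective in the Poisson arrival model. That is, there is an absolute constant $C>0$ (independent of the instance, of $\Lambda$, of $\alpha$ and of the algorithm) such that the former is at least $(1-C\alpha\Lambda^{ -1/2})$ times the latter.
   Context: Let $I$ be a finite set of online vertex types and $J$ a finite set of offline vertices. For $i\in I$, $j\in J$, $w_{ij}\ge 0$ is the weight of matching an online vertex of type $i$ to $j$. Type $i$ has arrival rate $\lambda_i>0$, and $\Lambda=\sum_{i\in I}\lambda_i$. Online stochastic matching: exactly $\Lambda$ online vertices arrive one at a time, each independently having type $i$ with probability $\lambda_i/\Lambda$. Poisson arrival model: the number of online vertices is a Poisson random variable with mean $\Lambda$; they arrive one at a time, each independently having type $i$ with probability $\lambda_i/\Lambda$. An online algorithm (possibly randomized) makes the matching decision for each online vertex irrevocably and immediately upon its arrival, processing the vertices in arrival order without knowing the future (in particular its treatment of the $n$-th vertex does not depend on the total number of online vertices). Its objective is the expected total weight of its matching. For $n\ge1$ let $\mathrm{ALG}_n$ be the expected weight that the algorithm gets from matching the $n$-th online vertex, so the objective when there are exactly $m$ online vertices is $\sum_{n=1}^m\mathrm{ALG}_n$. The algorithm is monotone if $\mathrm{ALG}_n$ is nonincreasing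 in $n$; it is $\alpha$-approximately monotone if $\mathrm{ALG}_n\le\alpha\cdot\mathrm{ALG}_\ell$ for all $n>\ell\ge1$. -}

module Defs where

open import Algebra.Bundles using (CommutativeRing; Semiring)
open import Data.Fin.Base using (Fin; zero; suc)
open import Data.List.Base using (List; []; _∷_)
open import Data.List.Relation.Unary.Any using (Any)
open import Data.Maybe.Base using (Maybe; nothing; just)
open import Data.Nat.Base as ℕ using (ℕ; zero; suc; NonZero; _!)
import Data.Nat.Properties as ℕ
open import Data.Nat.Solver using (module +-*-Solver)
open import Data.Product.Base using (∃-syntax; _×_; _,_; proj₁; proj₂)
open import Data.Sum.Base using (_⊎_; inj₁; inj₂)
open import Level using (Level; _⊔_)
open import Relation.Binary.Core using (Rel)
open import Relation.Binary.Definitions using (Cotransitive)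
open import Relation.Binary.PropositionalEquality as ≡ using (_≡_)
open import Relation.Binary.Structures using (IsStrictPartialOrder; IsPreorder)
open import Relation.Nullary using (¬_; yes; no; contradiction)

-- Decidability of the order is not assumed, so that constructive models of
-- the reals qualify as well; accordingly x ≤ y is the negation of y < x.
record OrderedField (c ℓ₁ ℓ₂ : Level) : Set (Level.suc (c ⊔ ℓ₁ ⊔ ℓ₂)) where
  infix 4 _<_ _≤_ ∣_-_∣<_ _⟶_
  field
    commutativeRing : CommutativeRing c ℓ₁

  open CommutativeRing commutativeRing public renaming (zero to *-zero)

  field
    _<_                  : Rel Carrier ℓ₂
    isStrictPartialOrder : IsStrictPartialOrder _≈_ _<_
    <-cotrans            : Cotransitive _<_
    <-tight              : ∀ {x y} → ¬ x < y → ¬ y < x → x ≈ y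
    0<1                  : 0# < 1#
    +-monoˡ-<            : ∀ z {x y} → x < y → x + z < y + z
    *-pos                : ∀ {x y} → 0# < x → 0# < y → 0# < x * y
    inverse              : ∀ {x} → 0# < x → ∃[ y ] (0# < y × x * y ≈ 1#)

  open import Algebra.Definitions.RawSemiring
    (Semiring.rawSemiring semiring) public
    using (_^_; sum)
    renaming (_×_ to _·_)

  _≤_ : Rel Carrier ℓ₂
  x ≤ y = ¬ y < x

  fromℕ : ℕ → Carrier
  fromℕ n = n · 1#

  ∣_-_∣<_ : Carrier → Carrier → Carrier → Set ℓ₂
  ∣ x - y ∣< ε = x < y + ε × y < x + ε

  Cauchy : (ℕ → Carrier) → Set (c ⊔ ℓ₂)
  Cauchy u = ∀ {ε} → 0# < ε →
    ∃[ N ] (∀ m n → N ℕ.≤ m → N ℕ.≤ n → ∣ u m - u n ∣< ε)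

  _⟶_ : (ℕ → Carrier) → Carrier → Set (c ⊔ ℓ₂)
  u ⟶ l = ∀ {ε} → 0# < ε → ∃[ N ] (∀ n → N ℕ.≤ n → ∣ u n - l ∣< ε)

-- Classically, any two Cauchy-complete Archimedean ordered fields are
-- isomorphic by a unique isomorphism.
record Reals (c ℓ₁ ℓ₂ : Level) : Set (Level.suc (c ⊔ ℓ₁ ⊔ ℓ₂)) where
  field
    orderedField : OrderedField c ℓ₁ ℓ₂

  open OrderedField orderedField public

  field
    archimedean : ∀ x → ∃[ n ] x < fromℕ n
    complete    : ∀ u → Cauchy u → ∃[ l ] u ⟶ l

module Bisection (n : ℕ) where
  open ℕ.≤-Reasoning
  open +-*-Solver using (solve; _:*_; _:+_; _:=_; con)

  w : ℕ
  w = suc n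

  lower upper : ℕ → ℕ
  lower r = r ℕ.* w
  upper r = suc r ℕ.* w

  -- √ n lies between lower r / 2ᵏ and upper r / 2ᵏ
  Bracket : ℕ → ℕ → Set
  Bracket k r = lower r ℕ.* lower r ℕ.≤ n ℕ.* 4 ℕ.^ k ×
                n ℕ.* 4 ℕ.^ k ℕ.≤ upper r ℕ.* upper r

  abstract
    n4^suc : ∀ k → n ℕ.* 4 ℕ.^ suc k ≡ 4 ℕ.* (n ℕ.* 4 ℕ.^ k)
    n4^suc k = solve 2
      (λ n p → n :* (con 4 :* p) := con 4 :* (n :* p)) ≡.refl n (4 ℕ.^ k)

    double-sq : ∀ a → (a ℕ.+ a) ℕ.* (a ℕ.+ a) ≡ 4 ℕ.* (a ℕ.* a)
    double-sq a = solve 1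
      (λ a → (a :+ a) :* (a :+ a) := con 4 :* (a :* a)) ≡.refl a

    lower-double : ∀ r → lower (r ℕ.+ r) ≡ lower r ℕ.+ lower r
    lower-double r = ℕ.*-distribʳ-+ w r r

    upper-double : ∀ r → upper (suc (r ℕ.+ r)) ≡ upper r ℕ.+ upper r
    upper-double r = ≡.trans (≡.cong (λ m → suc m ℕ.* w) (≡.sym (ℕ.+-suc r r)))
      (ℕ.*-distribʳ-+ w (suc r) (suc r))

    refine : ∀ k r → Bracket k r → ∃[ r′ ]
      (Bracket (suc k) r′ × r ℕ.+ r ℕ.≤ r′ × r′ ℕ.≤ suc (r ℕ.+ r))
    refine k r (lo , hi)
      with upper (r ℕ.+ r) ℕ.* upper (r ℕ.+ r) ℕ.≤? n ℕ.* 4 ℕ.^ suc k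
    ... | yes mid≤ = suc (r ℕ.+ r) , (mid≤ , hi′) , ℕ.n≤1+n _ , ℕ.≤-refl
      where
      hi′ : n ℕ.* 4 ℕ.^ suc k ℕ.≤ upper (suc (r ℕ.+ r)) ℕ.* upper (suc (r ℕ.+ r))
      hi′ = begin
        n ℕ.* 4 ℕ.^ suc k            ≡⟨ n4^suc k ⟩
        4 ℕ.* (n ℕ.* 4 ℕ.^ k)        ≤⟨ ℕ.*-monoʳ-≤ 4 hi ⟩
        4 ℕ.* (upper r ℕ.* upper r)  ≡⟨ double-sq (upper r) ⟨
        (upper r ℕ.+ upper r) ℕ.* (upper r ℕ.+ upper r)
          ≡⟨ ≡.cong₂ ℕ._*_ (upper-double r) (upper-double r) ⟨
        upper (suc (r ℕ.+ r)) ℕ.* upper (suc (r ℕ.+ r)) ∎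
    ... | no mid≰ = r ℕ.+ r , (lo′ , ℕ.<⇒≤ (ℕ.≰⇒> mid≰)) , ℕ.≤-refl , ℕ.n≤1+n _
      where
      lo′ : lower (r ℕ.+ r) ℕ.* lower (r ℕ.+ r) ℕ.≤ n ℕ.* 4 ℕ.^ suc k
      lo′ = begin
        lower (r ℕ.+ r) ℕ.* lower (r ℕ.+ r)
          ≡⟨ ≡.cong₂ ℕ._*_ (lower-double r) (lower-double r) ⟩
        (lower r ℕ.+ lower r) ℕ.* (lower r ℕ.+ lower r) ≡⟨ double-sq (lower r) ⟩
        4 ℕ.* (lower r ℕ.* lower r)  ≤⟨ ℕ.*-monoʳ-≤ 4 lo ⟩
        4 ℕ.* (n ℕ.* 4 ℕ.^ k)        ≡⟨ n4^suc k ⟨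
        n ℕ.* 4 ℕ.^ suc k            ∎

    bracket : ∀ k → ∃[ r ] Bracket k r
    bracket zero    = 0 , ℕ.z≤n , (begin
      n ℕ.* 1              ≡⟨ ℕ.*-identityʳ n ⟩
      n                    ≤⟨ ℕ.n≤1+n n ⟩
      w                    ≤⟨ ℕ.m≤m*n w w ⟩
      w ℕ.* w              ≡⟨ ≡.cong₂ ℕ._*_ (ℕ.*-identityˡ w) (ℕ.*-identityˡ w) ⟨
      upper 0 ℕ.* upper 0  ∎)
    bracket (suc k) with refine k (proj₁ (bracket k)) (proj₂ (bracket k))
    ... | r′ , b , _ = r′ , b

    pos : ℕ → ℕ
    pos k = proj₁ (bracket k)

    pos-lower : ∀ k → pos k ℕ.+ pos k ℕ.≤ pos (suc k)
    pos-lower k = proj₁ (proj₂ (proj₂ (refine k (proj₁ (bracket k)) (proj₂ (bracket k)))))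

    pos-upper : ∀ k → pos (suc k) ℕ.≤ suc (pos k ℕ.+ pos k)
    pos-upper k = proj₂ (proj₂ (proj₂ (refine k (proj₁ (bracket k)) (proj₂ (bracket k)))))

    brackets : ∀ k → Bracket k (pos k)
    brackets k = proj₂ (bracket k)

module RealProperties {c ℓ₁ ℓ₂} (ℝ : Reals c ℓ₁ ℓ₂) where
  open Reals ℝ
  open import Algebra.Properties.Semiring.Mult semiring
    using (×-homo-+; ×1-homo-*)
  open import Algebra.Solver.Ring.NaturalCoefficients.Default
    commutativeSemiring using (solve; _:=_; _:+_; _:*_; con)
  private
    module < = IsStrictPartialOrder isStrictPartialOrder

  <-asym : ∀ {x y} → x < y → ¬ y < x
  <-asym = <.asym

  <⇒≤ : ∀ {x y} → x < y → x ≤ y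
  <⇒≤ = <-asym

  ≤-reflexive : ∀ {x y} → x ≈ y → x ≤ y
  ≤-reflexive x≈y = <.irrefl (sym x≈y)

  ≤-refl : ∀ {x} → x ≤ x
  ≤-refl = ≤-reflexive refl

  <-≤-trans : ∀ {x y z} → x < y → y ≤ z → x < z
  <-≤-trans {z = z} x<y y≤z with <-cotrans x<y z
  ... | inj₁ x<z = x<z
  ... | inj₂ z<y = contradiction z<y y≤z

  ≤-<-trans : ∀ {x y z} → x ≤ y → y < z → x < z
  ≤-<-trans {x} x≤y y<z with <-cotrans y<z x
  ... | inj₁ y<x = contradiction y<x x≤y
  ... | inj₂ x<z = x<z

  ≤-trans : ∀ {x y z} → x ≤ y → y ≤ z → x ≤ z
  ≤-trans x≤y y≤z z<x = y≤z (<-≤-trans z<x x≤y)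

  ≤-isPreorder : IsPreorder _≈_ _≤_
  ≤-isPreorder = record
    { isEquivalence = isEquivalence
    ; reflexive     = ≤-reflexive
    ; trans         = ≤-trans
    }

  module ≤-Reasoning where
    open import Relation.Binary.Reasoning.Base.Triple
      ≤-isPreorder <-asym <.trans <.<-resp-≈ <⇒≤ <-≤-trans ≤-<-trans public

  open ≤-Reasoning

  ≤-¬¬split : ∀ {x y} → x ≤ y → ¬ ¬ (x < y ⊎ x ≈ y)
  ≤-¬¬split x≤y k = k (inj₂ (<-tight (λ x<y → k (inj₁ x<y)) x≤y))

  x-y+y≈x : ∀ x y → (x - y) + y ≈ x
  x-y+y≈x x y = trans (+-assoc x (- y) y)
    (trans (+-congˡ (-‿inverseˡ y)) (+-identityʳ x))

  +-cancelʳ-< : ∀ z {x y} → x + z < y + z → x < y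
  +-cancelʳ-< z {x} {y} x+z<y+z = begin-strict
    x               ≈⟨ x+z-z≈x x ⟨
    (x + z) + (- z) <⟨ +-monoˡ-< (- z) x+z<y+z ⟩
    (y + z) + (- z) ≈⟨ x+z-z≈x y ⟩
    y               ∎
    where
    x+z-z≈x : ∀ w → (w + z) + (- z) ≈ w
    x+z-z≈x w = trans (+-assoc w z (- z))
      (trans (+-congˡ (-‿inverseʳ z)) (+-identityʳ w))

  +-monoˡ-≤ : ∀ z {x y} → x ≤ y → x + z ≤ y + z
  +-monoˡ-≤ z x≤y y+z<x+z = x≤y (+-cancelʳ-< z y+z<x+z)

  +-monoʳ-≤ : ∀ z {x y} → x ≤ y → z + x ≤ z + y
  +-monoʳ-≤ z {x} {y} x≤y = begin
    z + x ≈⟨ +-comm z x ⟩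
    x + z ≤⟨ +-monoˡ-≤ z x≤y ⟩
    y + z ≈⟨ +-comm y z ⟩
    z + y ∎

  +-mono-≤ : ∀ {x y u v} → x ≤ y → u ≤ v → x + u ≤ y + v
  +-mono-≤ x≤y u≤v = ≤-trans (+-monoˡ-≤ _ x≤y) (+-monoʳ-≤ _ u≤v)

  +-monoʳ-< : ∀ z {x y} → x < y → z + x < z + y
  +-monoʳ-< z {x} {y} x<y = begin-strict
    z + x ≈⟨ +-comm z x ⟩
    x + z <⟨ +-monoˡ-< z x<y ⟩
    y + z ≈⟨ +-comm y z ⟩
    z + y ∎

  +-nonneg : ∀ {x y} → 0# ≤ x → 0# ≤ y → 0# ≤ x + y
  +-nonneg {x} {y} 0≤x 0≤y = begin
    0#      ≈⟨ +-identityʳ 0# ⟨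
    0# + 0# ≤⟨ +-mono-≤ 0≤x 0≤y ⟩
    x + y   ∎

  x≤x+y : ∀ {x y} → 0# ≤ y → x ≤ x + y
  x≤x+y {x} {y} 0≤y = begin
    x      ≈⟨ +-identityʳ x ⟨
    x + 0# ≤⟨ +-monoʳ-≤ x 0≤y ⟩
    x + y  ∎

  x<y⇒0<y-x : ∀ {x y} → x < y → 0# < y - x
  x<y⇒0<y-x {x} {y} x<y = begin-strict
    0#      ≈⟨ -‿inverseʳ x ⟨
    x + - x <⟨ +-monoˡ-< (- x) x<y ⟩
    y - x   ∎

  *-monoʳ-<-pos : ∀ z → 0# < z → ∀ {x y} → x < y → z * x < z * y
  *-monoʳ-<-pos z 0<z {x} {y} x<y = begin-strict
    z * x                 ≈⟨ +-identityˡ (z * x) ⟨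
    0# + z * x            <⟨ +-monoˡ-< (z * x) (*-pos 0<z (x<y⇒0<y-x x<y)) ⟩
    z * (y - x) + z * x   ≈⟨ distribˡ z (y - x) x ⟨
    z * ((y - x) + x)     ≈⟨ *-congˡ (x-y+y≈x y x) ⟩
    z * y                 ∎

  *-monoʳ-≤ : ∀ z → 0# ≤ z → ∀ {x y} → x ≤ y → z * x ≤ z * y
  *-monoʳ-≤ z 0≤z {x} {y} x≤y zy<zx =
    ≤-¬¬split 0≤z λ where
      (inj₂ 0≈z) → ≤-reflexive
        (trans (trans (*-congʳ (sym 0≈z)) (zeroˡ x))
               (sym (trans (*-congʳ (sym 0≈z)) (zeroˡ y)))) zy<zx
      (inj₁ 0<z) → ≤-¬¬split x≤y λ where
        (inj₁ x<y) → <-asym (*-monoʳ-<-pos z 0<z x<y) zy<zx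
        (inj₂ x≈y) → ≤-reflexive (*-congˡ x≈y) zy<zx

  *-monoˡ-≤ : ∀ z → 0# ≤ z → ∀ {x y} → x ≤ y → x * z ≤ y * z
  *-monoˡ-≤ z 0≤z {x} {y} x≤y = begin
    x * z ≈⟨ *-comm x z ⟩
    z * x ≤⟨ *-monoʳ-≤ z 0≤z x≤y ⟩
    z * y ≈⟨ *-comm z y ⟩
    y * z ∎

  *-nonneg : ∀ {x y} → 0# ≤ x → 0# ≤ y → 0# ≤ x * y
  *-nonneg {x} {y} 0≤x 0≤y = begin
    0#     ≈⟨ zeroʳ x ⟨
    x * 0# ≤⟨ *-monoʳ-≤ x 0≤x 0≤y ⟩
    x * y  ∎

  *-mono-≤ : ∀ {x y u v} → 0# ≤ x → 0# ≤ v → x ≤ y → u ≤ v → x * u ≤ y * v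
  *-mono-≤ 0≤x 0≤v x≤y u≤v =
    ≤-trans (*-monoʳ-≤ _ 0≤x u≤v) (*-monoˡ-≤ _ 0≤v x≤y)

  square-mono : ∀ x y → 0# ≤ x → x ≤ y → x * x ≤ y * y
  square-mono x y 0≤x x≤y = *-mono-≤ 0≤x (≤-trans 0≤x x≤y) x≤y x≤y

  1≤square⇒pos : ∀ x → 0# ≤ x → 1# ≤ x * x → 0# < x
  1≤square⇒pos x 0≤x 1≤x² with <-cotrans 0<1 x
  ... | inj₁ 0<x = 0<x
  ... | inj₂ x<1 = contradiction x*x<1 1≤x²
    where
    x*x<1 : x * x < 1#
    x*x<1 = begin-strict
      x * x  ≤⟨ *-monoʳ-≤ x 0≤x (<⇒≤ x<1) ⟩
      x * 1# ≈⟨ *-identityʳ x ⟩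
      x      <⟨ x<1 ⟩
      1#     ∎

  sum-mono : ∀ {n} {f g : Fin n → Carrier} → (∀ i → f i ≤ g i) → sum f ≤ sum g
  sum-mono {zero}  f≤g = ≤-refl
  sum-mono {suc n} f≤g = +-mono-≤ (f≤g zero) (sum-mono (λ i → f≤g (suc i)))

  sum-nonneg : ∀ {n} {f : Fin n → Carrier} → (∀ i → 0# ≤ f i) → 0# ≤ sum f
  sum-nonneg {zero}  0≤f = ≤-refl
  sum-nonneg {suc n} 0≤f = +-nonneg (0≤f zero) (sum-nonneg (λ i → 0≤f (suc i)))

  term≤sum : ∀ {n} (f : Fin n → Carrier) → (∀ i → 0# ≤ f i) → ∀ i → f i ≤ sum f
  term≤sum f 0≤f zero    = x≤x+y (sum-nonneg (λ i → 0≤f (suc i)))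
  term≤sum f 0≤f (suc i) = begin
    f (suc i)                           ≤⟨ term≤sum (λ i → f (suc i)) (λ i → 0≤f (suc i)) i ⟩
    sum (λ i → f (suc i))               ≈⟨ +-identityˡ _ ⟨
    0# + sum (λ i → f (suc i))          ≤⟨ +-monoˡ-≤ _ (0≤f zero) ⟩
    f zero + sum (λ i → f (suc i))      ∎

  *-cancelʳ-≤-pos : ∀ z → 0# < z → ∀ {x y} → x * z ≤ y * z → x ≤ y
  *-cancelʳ-≤-pos z 0<z {x} {y} xz≤yz y<x = xz≤yz (begin-strict
    y * z ≈⟨ *-comm y z ⟩
    z * y <⟨ *-monoʳ-<-pos z 0<z y<x ⟩
    z * x ≈⟨ *-comm z x ⟩
    x * z ∎)

  0≤1 : 0# ≤ 1#
  0≤1 = <⇒≤ 0<1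

  fromℕ-nonneg : ∀ n → 0# ≤ fromℕ n
  fromℕ-nonneg zero    = ≤-refl
  fromℕ-nonneg (suc n) = +-nonneg 0≤1 (fromℕ-nonneg n)

  fromℕ-pos : ∀ n .{{_ : NonZero n}} → 0# < fromℕ n
  fromℕ-pos (suc n) = <-≤-trans 0<1 (x≤x+y (fromℕ-nonneg n))

  fromℕ-mono-≤ : ∀ {m n} → m ℕ.≤ n → fromℕ m ≤ fromℕ n
  fromℕ-mono-≤ {n = n} ℕ.z≤n  = fromℕ-nonneg n
  fromℕ-mono-≤ (ℕ.s≤s m≤n)    = +-monoʳ-≤ 1# (fromℕ-mono-≤ m≤n)

  fromℕ-* : ∀ m n → fromℕ (m ℕ.* n) ≈ fromℕ m * fromℕ n
  fromℕ-* = ×1-homo-*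

  fromℕ-+ : ∀ m n → fromℕ (m ℕ.+ n) ≈ fromℕ m + fromℕ n
  fromℕ-+ = ×-homo-+ 1#

  ^-nonneg : ∀ {x} → 0# ≤ x → ∀ n → 0# ≤ x ^ n
  ^-nonneg 0≤x zero    = 0≤1
  ^-nonneg 0≤x (suc n) = *-nonneg 0≤x (^-nonneg 0≤x n)

  reciprocal : ∀ x → 0# < x → Carrier
  reciprocal x 0<x = proj₁ (inverse 0<x)

  reciprocal-pos : ∀ {x} (0<x : 0# < x) → 0# < reciprocal x 0<x
  reciprocal-pos 0<x = proj₁ (proj₂ (inverse 0<x))

  reciprocal-inverseʳ : ∀ {x} (0<x : 0# < x) → x * reciprocal x 0<x ≈ 1#
  reciprocal-inverseʳ 0<x = proj₂ (proj₂ (inverse 0<x))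

  reciprocal-unique : ∀ {x y} (0<x : 0# < x) → x * y ≈ 1# → y ≈ reciprocal x 0<x
  reciprocal-unique {x} {y} 0<x xy≈1 = begin-equality
    y            ≈⟨ *-identityʳ y ⟨
    y * 1#       ≈⟨ *-congˡ (reciprocal-inverseʳ 0<x) ⟨
    y * (x * x⁻¹) ≈⟨ solve 3 (λ y x z → y :* (x :* z) := (x :* y) :* z) refl y x x⁻¹ ⟩
    (x * y) * x⁻¹ ≈⟨ *-congʳ xy≈1 ⟩
    1# * x⁻¹     ≈⟨ *-identityˡ x⁻¹ ⟩
    x⁻¹          ∎
    where x⁻¹ = reciprocal x 0<x

  infix 9 1/_
  1/_ : ∀ n .{{_ : NonZero n}} → Carrier
  1/ n = reciprocal (fromℕ n) (fromℕ-pos n)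

  ½ : Carrier
  ½ = 1/ 2

  0≤½ : 0# ≤ ½
  0≤½ = <⇒≤ (reciprocal-pos (fromℕ-pos 2))

  ½+½≈1 : ½ + ½ ≈ 1#
  ½+½≈1 = trans
    (solve 1 (λ h → h :+ h := (con 1 :+ (con 1 :+ con 0)) :* h) refl ½)
    (reciprocal-inverseʳ (fromℕ-pos 2))

  x½+x½≈x : ∀ x → x * ½ + x * ½ ≈ x
  x½+x½≈x x = trans (sym (distribˡ x ½ ½)) (trans (*-congˡ ½+½≈1) (*-identityʳ x))

  ½^-nonneg : ∀ k → 0# ≤ ½ ^ k
  ½^-nonneg = ^-nonneg 0≤½

  ½≤1 : ½ ≤ 1#
  ½≤1 = begin
    ½     ≤⟨ x≤x+y 0≤½ ⟩
    ½ + ½ ≈⟨ ½+½≈1 ⟩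
    1#    ∎

  ½^≤1 : ∀ k → ½ ^ k ≤ 1#
  ½^≤1 zero    = ≤-refl
  ½^≤1 (suc k) = begin
    ½ * ½ ^ k ≤⟨ *-mono-≤ 0≤½ 0≤1 ½≤1 (½^≤1 k) ⟩
    1# * 1#   ≈⟨ *-identityʳ 1# ⟩
    1#        ∎

  n½^n≤1 : ∀ n → fromℕ n * ½ ^ n ≤ 1#
  n½^n≤1 zero    = ≤-trans (≤-reflexive (zeroˡ _)) 0≤1
  n½^n≤1 (suc n) = begin
    (1# + fromℕ n) * (½ * ½ ^ n)
      ≈⟨ solve 3 (λ h p n → (con 1 :+ n) :* (h :* p) := h :* (p :+ n :* p))
           refl ½ (½ ^ n) (fromℕ n) ⟩
    ½ * (½ ^ n + fromℕ n * ½ ^ n)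
      ≤⟨ *-monoʳ-≤ ½ 0≤½ (+-mono-≤ (½^≤1 n) (n½^n≤1 n)) ⟩
    ½ * (1# + 1#)
      ≈⟨ solve 1 (λ h → h :* (con 1 :+ con 1) := h :+ h) refl ½ ⟩
    ½ + ½
      ≈⟨ ½+½≈1 ⟩
    1# ∎

  ½^-vanishes : ∀ L {ε} → 0# < ε → ∃[ k ] L * ½ ^ k < ε
  ½^-vanishes L {ε} 0<ε = n , (begin-strict
    L * ½ ^ n                 ≈⟨ *-congʳ L≈ ⟩
    (ε * (ε⁻¹ * L)) * ½ ^ n   <⟨ *-monoˡ-<-pos (½ ^ n) (½^-pos n) (*-monoʳ-<-pos ε 0<ε (proj₂ arch)) ⟩
    (ε * fromℕ n) * ½ ^ n     ≈⟨ *-assoc _ _ _ ⟩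
    ε * (fromℕ n * ½ ^ n)     ≤⟨ *-monoʳ-≤ ε (<⇒≤ 0<ε) (n½^n≤1 n) ⟩
    ε * 1#                    ≈⟨ *-identityʳ ε ⟩
    ε                         ∎)
    where
    ε⁻¹ = reciprocal ε 0<ε
    arch = archimedean (ε⁻¹ * L)
    n = proj₁ arch
    L≈ : L ≈ ε * (ε⁻¹ * L)
    L≈ = sym (trans (sym (*-assoc _ _ _))
      (trans (*-congʳ (reciprocal-inverseʳ 0<ε)) (*-identityˡ L)))
    ½^-pos : ∀ k → 0# < ½ ^ k
    ½^-pos zero    = 0<1
    ½^-pos (suc k) = *-pos (reciprocal-pos (fromℕ-pos 2)) (½^-pos k)
    *-monoˡ-<-pos : ∀ z → 0# < z → ∀ {x y} → x < y → x * z < y * z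
    *-monoˡ-<-pos z 0<z {x} {y} x<y = begin-strict
      x * z ≈⟨ *-comm x z ⟩
      z * x <⟨ *-monoʳ-<-pos z 0<z x<y ⟩
      z * y ≈⟨ *-comm z y ⟩
      y * z ∎

  ≤-from-½^ : ∀ x y L → (∀ k → x ≤ y + L * ½ ^ k) → x ≤ y
  ≤-from-½^ x y L bound y<x = bound k (begin-strict
    y + L * ½ ^ k <⟨ +-monoʳ-< y (proj₂ small) ⟩
    y + (x - y)   ≈⟨ +-comm y (x - y) ⟩
    (x - y) + y   ≈⟨ x-y+y≈x x y ⟩
    x             ∎)
    where
    small = ½^-vanishes L (x<y⇒0<y-x y<x)
    k = proj₁ small

  Nondecreasing Nonincreasing : (ℕ → Carrier) → Set ℓ₂
  Nondecreasing u = ∀ n → u n ≤ u (suc n)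
  Nonincreasing u = ∀ n → u (suc n) ≤ u n

  nondecreasing-≤ : ∀ {u} → Nondecreasing u → ∀ {m n} → m ℕ.≤ n → u m ≤ u n
  nondecreasing-≤ {u} inc {m} m≤n = go (ℕ.≤⇒≤′ m≤n)
    where
    go : ∀ {n} → m ℕ.≤′ n → u m ≤ u n
    go (ℕ.≤′-reflexive ≡.refl) = ≤-refl
    go (ℕ.≤′-step m≤′n)        = ≤-trans (go m≤′n) (inc _)

  nonincreasing-≤ : ∀ {u} → Nonincreasing u → ∀ {m n} → m ℕ.≤ n → u n ≤ u m
  nonincreasing-≤ {u} dec {m} m≤n = go (ℕ.≤⇒≤′ m≤n)
    where
    go : ∀ {n} → m ℕ.≤′ n → u n ≤ u m
    go (ℕ.≤′-reflexive ≡.refl) = ≤-refl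
    go (ℕ.≤′-step m≤′n)        = ≤-trans (dec _) (go m≤′n)

  bracketed-cauchy : ∀ {u} L → 0# ≤ L → Nondecreasing u →
    Nonincreasing (λ k → u k + L * ½ ^ k) → Cauchy u
  bracketed-cauchy {u} L 0≤L inc dec {ε} 0<ε =
    N , λ m n N≤m N≤n → close m n N≤m N≤n , close n m N≤n N≤m
    where
    small = ½^-vanishes L 0<ε
    N = proj₁ small
    close : ∀ m n → N ℕ.≤ m → N ℕ.≤ n → u m < u n + ε
    close m n N≤m N≤n = begin-strict
      u m             ≤⟨ x≤x+y (*-nonneg 0≤L (½^-nonneg m)) ⟩
      u m + L * ½ ^ m ≤⟨ nonincreasing-≤ dec N≤m ⟩
      u N + L * ½ ^ N <⟨ +-monoʳ-< (u N) (proj₂ small) ⟩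
      u N + ε         ≤⟨ +-monoˡ-≤ ε (nondecreasing-≤ inc N≤n) ⟩
      u n + ε         ∎

  unshift-cauchy : ∀ {u} M → Cauchy (λ k → u (M ℕ.+ k)) → Cauchy u
  unshift-cauchy {u} M cau 0<ε with cau 0<ε
  ... | N , close = M ℕ.+ N , λ m n M+N≤m M+N≤n →
    ≡.subst₂ (λ i j → ∣ u i - u j ∣< _) (ok M+N≤m) (ok M+N≤n)
      (close (m ℕ.∸ M) (n ℕ.∸ M) (N≤ M+N≤m) (N≤ M+N≤n))
    where
    ok : ∀ {m} → M ℕ.+ N ℕ.≤ m → M ℕ.+ (m ℕ.∸ M) ≡ m
    ok M+N≤m = ℕ.m+[n∸m]≡n (ℕ.≤-trans (ℕ.m≤m+n M N) M+N≤m)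
    N≤ : ∀ {m} → M ℕ.+ N ℕ.≤ m → N ℕ.≤ m ℕ.∸ M
    N≤ {m} M+N≤m = ≡.subst (ℕ._≤ m ℕ.∸ M) (ℕ.m+n∸m≡n M N) (ℕ.∸-monoˡ-≤ M M+N≤m)

  limit-≥ : ∀ {u l x} N → u ⟶ l → (∀ n → N ℕ.≤ n → x ≤ u n) → x ≤ l
  limit-≥ {u} {l} {x} N u⟶l x≤u l<x with u⟶l (x<y⇒0<y-x l<x)
  ... | M , close = x≤u (M ℕ.+ N) (ℕ.m≤n+m N M) (begin-strict
    u (M ℕ.+ N)  <⟨ proj₁ (close (M ℕ.+ N) (ℕ.m≤m+n M N)) ⟩
    l + (x - l)  ≈⟨ +-comm l (x - l) ⟩
    (x - l) + l  ≈⟨ x-y+y≈x x l ⟩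
    x            ∎)

  limit-≤ : ∀ {u l x} N → u ⟶ l → (∀ n → N ℕ.≤ n → u n ≤ x) → l ≤ x
  limit-≤ {u} {l} {x} N u⟶l u≤x x<l with u⟶l (x<y⇒0<y-x x<l)
  ... | M , close = ≤-refl (begin-strict
    l                       <⟨ proj₂ (close (M ℕ.+ N) (ℕ.m≤m+n M N)) ⟩
    u (M ℕ.+ N) + (l - x)   ≤⟨ +-monoˡ-≤ (l - x) (u≤x (M ℕ.+ N) (ℕ.m≤n+m N M)) ⟩
    x + (l - x)             ≈⟨ +-comm x (l - x) ⟩
    (l - x) + x             ≈⟨ x-y+y≈x l x ⟩
    l                       ∎)

  partialSum : (ℕ → Carrier) → ℕ → Carrier
  partialSum a zero    = 0#
  partialSum a (suc n) = partialSum a n + a n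

  Summable : (ℕ → Carrier) → Set (c ⊔ ℓ₂)
  Summable a = Cauchy (partialSum a)

  Σ∞ : ∀ a → Summable a → Carrier
  Σ∞ a summable = proj₁ (complete (partialSum a) summable)

  Σ∞-converges : ∀ a (s : Summable a) → partialSum a ⟶ Σ∞ a s
  Σ∞-converges a summable = proj₂ (complete (partialSum a) summable)

  geometric-test : ∀ {a} M K → 0# ≤ K → (∀ n → 0# ≤ a n) →
    (∀ k → a (M ℕ.+ k) ≤ K * ½ ^ k) → Summable a
  geometric-test {a} M K 0≤K 0≤a bound =
    unshift-cauchy M (bracketed-cauchy (K + K) (+-nonneg 0≤K 0≤K) inc dec)
    where
    S : ℕ → Carrier
    S k = partialSum a (M ℕ.+ k)
    S-suc : ∀ k → S (suc k) ≡ S k + a (M ℕ.+ k)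
    S-suc k = ≡.cong (partialSum a) (ℕ.+-suc M k)
    inc : Nondecreasing S
    inc k = begin
      S k               ≤⟨ x≤x+y (0≤a (M ℕ.+ k)) ⟩
      S k + a (M ℕ.+ k) ≡⟨ S-suc k ⟨
      S (suc k)         ∎
    dec : Nonincreasing (λ k → S k + (K + K) * ½ ^ k)
    dec k = begin
      S (suc k) + (K + K) * (½ * ½ ^ k)
        ≡⟨ ≡.cong (_+ (K + K) * (½ * ½ ^ k)) (S-suc k) ⟩
      S k + a (M ℕ.+ k) + (K + K) * (½ * ½ ^ k)
        ≤⟨ +-monoˡ-≤ _ (+-monoʳ-≤ (S k) (bound k)) ⟩
      S k + K * ½ ^ k + (K + K) * (½ * ½ ^ k)
        ≈⟨ solve 4 (λ s K h p → s :+ K :* p :+ (K :+ K) :* (h :* p)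
             := s :+ (K :* p :+ K :* p :* (h :+ h))) refl (S k) K ½ (½ ^ k) ⟩
      S k + (K * ½ ^ k + K * ½ ^ k * (½ + ½))
        ≈⟨ +-congˡ (+-congˡ (trans (*-congˡ ½+½≈1) (*-identityʳ _))) ⟩
      S k + (K * ½ ^ k + K * ½ ^ k)
        ≈⟨ +-congˡ (distribʳ (½ ^ k) K K) ⟨
      S k + (K + K) * ½ ^ k ∎

  expTerm : ℕ → ℕ → Carrier
  expTerm x k = fromℕ x ^ k * 1/_ (k !) {{k ℕ.!≢0}}

  expTerm-nonneg : ∀ x k → 0# ≤ expTerm x k
  expTerm-nonneg x k = *-nonneg (^-nonneg (fromℕ-nonneg x) k)
    (<⇒≤ (reciprocal-pos (fromℕ-pos (k !) {{k ℕ.!≢0}})))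

  expTerm-suc : ∀ x k → expTerm x (suc k) * fromℕ (suc k) ≈ expTerm x k * fromℕ x
  expTerm-suc x k = begin-equality
    (fromℕ x * xᵏ * r₁) * fromℕ (suc k)
      ≈⟨ solve 4 (λ x p r s → (x :* p :* r) :* s := (p :* (s :* r)) :* x)
           refl (fromℕ x) xᵏ r₁ (fromℕ (suc k)) ⟩
    (xᵏ * (fromℕ (suc k) * r₁)) * fromℕ x
      ≈⟨ *-congʳ (*-congˡ (reciprocal-unique (fromℕ-pos (k !) {{k ℕ.!≢0}}) (begin-equality
           fromℕ (k !) * (fromℕ (suc k) * r₁)
             ≈⟨ solve 3 (λ f s r → f :* (s :* r) := (s :* f) :* r)
                  refl (fromℕ (k !)) (fromℕ (suc k)) r₁ ⟩
           (fromℕ (suc k) * fromℕ (k !)) * r₁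
             ≈⟨ *-congʳ (fromℕ-* (suc k) (k !)) ⟨
           fromℕ (suc k !) * r₁
             ≈⟨ reciprocal-inverseʳ (fromℕ-pos (suc k !) {{suc k ℕ.!≢0}}) ⟩
           1# ∎))) ⟩
    expTerm x k * fromℕ x ∎
    where
    xᵏ = fromℕ x ^ k
    r₁ = 1/_ (suc k !) {{suc k ℕ.!≢0}}

  expTerm-halves : ∀ x k → x ℕ.+ x ℕ.≤ suc k → expTerm x (suc k) ≤ expTerm x k * ½
  expTerm-halves x k 2x≤k+1 = *-cancelʳ-≤-pos (fromℕ (suc k)) (fromℕ-pos (suc k)) (begin
    expTerm x (suc k) * fromℕ (suc k)    ≈⟨ expTerm-suc x k ⟩
    t * fromℕ x                          ≈⟨ *-congˡ (x½+x½≈x (fromℕ x)) ⟨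
    t * (fromℕ x * ½ + fromℕ x * ½)
      ≈⟨ solve 3 (λ t x h → t :* (x :* h :+ x :* h) := (t :* h) :* (x :+ x)) refl t (fromℕ x) ½ ⟩
    (t * ½) * (fromℕ x + fromℕ x)        ≈⟨ *-congˡ (fromℕ-+ x x) ⟨
    (t * ½) * fromℕ (x ℕ.+ x)
      ≤⟨ *-monoʳ-≤ (t * ½) (*-nonneg (expTerm-nonneg x k) 0≤½) (fromℕ-mono-≤ 2x≤k+1) ⟩
    (t * ½) * fromℕ (suc k)              ∎)
    where t = expTerm x k

  expTerm-geometric : ∀ x k →
    expTerm x (x ℕ.+ x ℕ.+ k) ≤ expTerm x (x ℕ.+ x) * ½ ^ k
  expTerm-geometric x zero = ≤-reflexive
    (trans (reflexive (≡.cong (expTerm x) (ℕ.+-identityʳ (x ℕ.+ x)))) (sym (*-identityʳ _)))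
  expTerm-geometric x (suc k) = begin
    expTerm x (M ℕ.+ suc k)     ≡⟨ ≡.cong (expTerm x) (ℕ.+-suc M k) ⟩
    expTerm x (suc (M ℕ.+ k))   ≤⟨ expTerm-halves x (M ℕ.+ k) (ℕ.m≤n⇒m≤1+n (ℕ.m≤m+n M k)) ⟩
    expTerm x (M ℕ.+ k) * ½     ≤⟨ *-monoˡ-≤ ½ 0≤½ (expTerm-geometric x k) ⟩
    expTerm x M * ½ ^ k * ½
      ≈⟨ solve 3 (λ t p h → t :* p :* h := t :* (h :* p)) refl (expTerm x M) (½ ^ k) ½ ⟩
    expTerm x M * (½ * ½ ^ k)   ∎
    where M = x ℕ.+ x

  expTerm-summable : ∀ x → Summable (expTerm x)
  expTerm-summable x = geometric-test (x ℕ.+ x) (expTerm x (x ℕ.+ x))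
    (expTerm-nonneg x (x ℕ.+ x)) (expTerm-nonneg x) (expTerm-geometric x)

  exp : ℕ → Carrier
  exp x = Σ∞ (expTerm x) (expTerm-summable x)

  exp-pos : ∀ x → 0# < exp x
  exp-pos x = <-≤-trans 0<1 (limit-≥ 1 (Σ∞-converges (expTerm x) (expTerm-summable x)) 1≤)
    where
    first : 0# + expTerm x 0 ≈ 1#
    first = trans (+-identityˡ _) (trans (*-congˡ (sym
      (reciprocal-unique (fromℕ-pos 1) (trans (*-identityʳ _) (+-identityʳ 1#))))) (*-identityʳ 1#))
    1≤ : ∀ n → 1 ℕ.≤ n → 1# ≤ partialSum (expTerm x) n
    1≤ n 1≤n = begin
      1#                        ≈⟨ first ⟨
      partialSum (expTerm x) 1  ≤⟨ nondecreasing-≤ {partialSum (expTerm x)} (λ k → x≤x+y (expTerm-nonneg x k)) 1≤n ⟩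
      partialSum (expTerm x) n  ∎

  exp⁻ : ℕ → Carrier
  exp⁻ x = reciprocal (exp x) (exp-pos x)

  module SquareRoot (n : ℕ) where
    open Bisection n
    private
      dyadic : ℕ → ℕ → Carrier
      dyadic a k = fromℕ a * ½ ^ k

      dyadic-double : ∀ a k → dyadic (a ℕ.+ a) (suc k) ≈ dyadic a k
      dyadic-double a k = begin-equality
        fromℕ (a ℕ.+ a) * (½ * ½ ^ k)           ≈⟨ *-congʳ (fromℕ-+ a a) ⟩
        (fromℕ a + fromℕ a) * (½ * ½ ^ k)
          ≈⟨ solve 3 (λ a h p → (a :+ a) :* (h :* p) := (a :* h :+ a :* h) :* p)
               refl (fromℕ a) ½ (½ ^ k) ⟩
        (fromℕ a * ½ + fromℕ a * ½) * ½ ^ k     ≈⟨ *-congʳ (x½+x½≈x (fromℕ a)) ⟩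
        fromℕ a * ½ ^ k                         ∎

      dyadic-mono : ∀ {a b} k → a ℕ.≤ b → dyadic a k ≤ dyadic b k
      dyadic-mono k a≤b = *-monoˡ-≤ (½ ^ k) (½^-nonneg k) (fromℕ-mono-≤ a≤b)

      4^½^½^≈1 : ∀ k → fromℕ (4 ℕ.^ k) * (½ ^ k * ½ ^ k) ≈ 1#
      4^½^½^≈1 zero = solve 0
        ((con 1 :+ con 0) :* (con 1 :* con 1) := con 1) refl
      4^½^½^≈1 (suc k) = begin-equality
        fromℕ (4 ℕ.* 4 ℕ.^ k) * (½ * ½ ^ k * (½ * ½ ^ k))
          ≈⟨ *-congʳ (fromℕ-* 4 (4 ℕ.^ k)) ⟩
        fromℕ 4 * fromℕ (4 ℕ.^ k) * (½ * ½ ^ k * (½ * ½ ^ k))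
          ≈⟨ solve 3 (λ f h p → (con 1 :+ (con 1 :+ (con 1 :+ (con 1 :+ con 0)))) :* f
               :* (h :* p :* (h :* p)) := (f :* (p :* p)) :* ((h :+ h) :* (h :+ h)))
               refl (fromℕ (4 ℕ.^ k)) ½ (½ ^ k) ⟩
        fromℕ (4 ℕ.^ k) * (½ ^ k * ½ ^ k) * ((½ + ½) * (½ + ½))
          ≈⟨ *-cong (4^½^½^≈1 k) (*-cong ½+½≈1 ½+½≈1) ⟩
        1# * (1# * 1#)
          ≈⟨ trans (*-identityˡ _) (*-identityˡ 1#) ⟩
        1# ∎

      dyadic-square : ∀ a k → dyadic a k * dyadic a k ≈ fromℕ (a ℕ.* a) * (½ ^ k * ½ ^ k)
      dyadic-square a k = trans
        (solve 2 (λ a p → (a :* p) :* (a :* p) := (a :* a) :* (p :* p)) refl (fromℕ a) (½ ^ k))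
        (*-congʳ (sym (fromℕ-* a a)))

      n≈ : ∀ k → fromℕ (n ℕ.* 4 ℕ.^ k) * (½ ^ k * ½ ^ k) ≈ fromℕ n
      n≈ k = trans (*-congʳ (fromℕ-* n (4 ℕ.^ k)))
        (trans (*-assoc _ _ _) (trans (*-congˡ (4^½^½^≈1 k)) (*-identityʳ _)))

      ½^½^-nonneg : ∀ k → 0# ≤ ½ ^ k * ½ ^ k
      ½^½^-nonneg k = *-nonneg (½^-nonneg k) (½^-nonneg k)

      W : Carrier
      W = fromℕ w

      u v : ℕ → Carrier
      u k = dyadic (lower (pos k)) k
      v k = dyadic (upper (pos k)) k

      u+≈v : ∀ k → u k + W * ½ ^ k ≈ v k
      u+≈v k = begin-equality
        fromℕ (lower (pos k)) * ½ ^ k + W * ½ ^ k  ≈⟨ distribʳ _ _ _ ⟨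
        (fromℕ (lower (pos k)) + W) * ½ ^ k        ≈⟨ *-congʳ (+-comm _ _) ⟩
        (W + fromℕ (lower (pos k))) * ½ ^ k        ≈⟨ *-congʳ (fromℕ-+ w (lower (pos k))) ⟨
        v k                                      ∎

      inc : Nondecreasing u
      inc k = begin
        u k                                    ≈⟨ dyadic-double (lower (pos k)) k ⟨
        dyadic (lower (pos k) ℕ.+ lower (pos k)) (suc k)
          ≡⟨ ≡.cong (λ a → dyadic a (suc k)) (lower-double (pos k)) ⟨
        dyadic (lower (pos k ℕ.+ pos k)) (suc k)
          ≤⟨ dyadic-mono (suc k) (ℕ.*-monoˡ-≤ w (pos-lower k)) ⟩
        u (suc k)                              ∎

      v-dec : Nonincreasing v
      v-dec k = begin
        v (suc k)
          ≤⟨ dyadic-mono (suc k) (ℕ.*-monoˡ-≤ w (ℕ.s≤s (pos-upper k))) ⟩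
        dyadic (upper (suc (pos k ℕ.+ pos k))) (suc k)
          ≡⟨ ≡.cong (λ a → dyadic a (suc k)) (upper-double (pos k)) ⟩
        dyadic (upper (pos k) ℕ.+ upper (pos k)) (suc k)
          ≈⟨ dyadic-double (upper (pos k)) k ⟩
        v k ∎

      dec : Nonincreasing (λ k → u k + W * ½ ^ k)
      dec k = begin
        u (suc k) + W * ½ ^ suc k  ≈⟨ u+≈v (suc k) ⟩
        v (suc k)                  ≤⟨ v-dec k ⟩
        v k                        ≈⟨ u+≈v k ⟨
        u k + W * ½ ^ k            ∎

      cauchy : Cauchy u
      cauchy = bracketed-cauchy W (fromℕ-nonneg w) inc dec

      s : Carrier
      s = proj₁ (complete u cauchy)

      u⟶s : u ⟶ s
      u⟶s = proj₂ (complete u cauchy)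

      u≤s : ∀ k → u k ≤ s
      u≤s k = limit-≥ k u⟶s (λ m → nondecreasing-≤ {u} inc)

      s≤v : ∀ k → s ≤ v k
      s≤v k = limit-≤ k u⟶s (λ m k≤m → begin
        u m              ≤⟨ x≤x+y (*-nonneg (fromℕ-nonneg w) (½^-nonneg m)) ⟩
        u m + W * ½ ^ m  ≈⟨ u+≈v m ⟩
        v m              ≤⟨ nonincreasing-≤ {v} v-dec k≤m ⟩
        v k              ∎)

      u-nonneg : ∀ k → 0# ≤ u k
      u-nonneg k = *-nonneg (fromℕ-nonneg (lower (pos k))) (½^-nonneg k)

      s-nonneg : 0# ≤ s
      s-nonneg = ≤-trans (u-nonneg 0) (u≤s 0)

      v-nonneg : ∀ k → 0# ≤ v k
      v-nonneg k = *-nonneg (fromℕ-nonneg (upper (pos k))) (½^-nonneg k)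

      u²≤n : ∀ k → u k * u k ≤ fromℕ n
      u²≤n k = begin
        u k * u k
          ≈⟨ dyadic-square (lower (pos k)) k ⟩
        fromℕ (lower (pos k) ℕ.* lower (pos k)) * (½ ^ k * ½ ^ k)
          ≤⟨ *-monoˡ-≤ _ (½^½^-nonneg k) (fromℕ-mono-≤ (proj₁ (brackets k))) ⟩
        fromℕ (n ℕ.* 4 ℕ.^ k) * (½ ^ k * ½ ^ k)
          ≈⟨ n≈ k ⟩
        fromℕ n ∎

      n≤v² : ∀ k → fromℕ n ≤ v k * v k
      n≤v² k = begin
        fromℕ n
          ≈⟨ n≈ k ⟨
        fromℕ (n ℕ.* 4 ℕ.^ k) * (½ ^ k * ½ ^ k)
          ≤⟨ *-monoˡ-≤ _ (½^½^-nonneg k) (fromℕ-mono-≤ (proj₂ (brackets k))) ⟩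
        fromℕ (upper (pos k) ℕ.* upper (pos k)) * (½ ^ k * ½ ^ k)
          ≈⟨ dyadic-square (upper (pos k)) k ⟨
        v k * v k ∎

      -- v exceeds u by W * ½ ^ k, so v² exceeds u² by at most this multiple of ½ ^ k
      excess : Carrier
      excess = W * (s + s + W)

      v²≤u²+ : ∀ k → v k * v k ≤ u k * u k + excess * ½ ^ k
      v²≤u²+ k = begin
        v k * v k
          ≈⟨ *-cong (u+≈v k) (u+≈v k) ⟨
        (u k + W * p) * (u k + W * p)
          ≈⟨ solve 3 (λ u w p → (u :+ w :* p) :* (u :+ w :* p) :=
               u :* u :+ (w :* (u :+ u :+ w :* p)) :* p) refl (u k) W p ⟩
        u k * u k + (W * (u k + u k + W * p)) * p
          ≤⟨ +-monoʳ-≤ _ (*-monoˡ-≤ p (½^-nonneg k) (*-monoʳ-≤ W (fromℕ-nonneg w)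
               (+-mono-≤ (+-mono-≤ (u≤s k) (u≤s k)) Wp≤W))) ⟩
        u k * u k + excess * p ∎
        where
        p = ½ ^ k
        Wp≤W : W * p ≤ W
        Wp≤W = begin
          W * p  ≤⟨ *-monoʳ-≤ W (fromℕ-nonneg w) (½^≤1 k) ⟩
          W * 1# ≈⟨ *-identityʳ W ⟩
          W      ∎

      s²≤n : s * s ≤ fromℕ n
      s²≤n = ≤-from-½^ (s * s) (fromℕ n) excess (λ k → begin
        s * s                       ≤⟨ square-mono s (v k) s-nonneg (s≤v k) ⟩
        v k * v k                   ≤⟨ v²≤u²+ k ⟩
        u k * u k + excess * ½ ^ k  ≤⟨ +-monoˡ-≤ _ (u²≤n k) ⟩
        fromℕ n + excess * ½ ^ k    ∎)

      n≤s² : fromℕ n ≤ s * s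
      n≤s² = ≤-from-½^ (fromℕ n) (s * s) excess (λ k → begin
        fromℕ n                     ≤⟨ n≤v² k ⟩
        v k * v k                   ≤⟨ v²≤u²+ k ⟩
        u k * u k + excess * ½ ^ k
          ≤⟨ +-monoˡ-≤ _ (square-mono (u k) s (u-nonneg k) (u≤s k)) ⟩
        s * s + excess * ½ ^ k      ∎)

    root : ∃[ s ] (0# ≤ s × s * s ≈ fromℕ n)
    root = s , s-nonneg , <-tight {s * s} {fromℕ n} n≤s² s²≤n

  √ : ℕ → Carrier
  √ n = proj₁ (SquareRoot.root n)

  √-nonneg : ∀ n → 0# ≤ √ n
  √-nonneg n = proj₁ (proj₂ (SquareRoot.root n))

  √-square : ∀ n → √ n * √ n ≈ fromℕ n
  √-square n = proj₂ (proj₂ (SquareRoot.root n))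

  √-pos : ∀ n .{{_ : NonZero n}} → 0# < √ n
  √-pos n@(suc m) = 1≤square⇒pos (√ n) (√-nonneg n)
    (≤-trans (x≤x+y {1#} {fromℕ m} (fromℕ-nonneg m)) (≤-reflexive (sym (√-square n))))

module OnlineMatching {c ℓ₁ ℓ₂} (ℝ : Reals c ℓ₁ ℓ₂) where
  open Reals ℝ
  open RealProperties ℝ
  open ≤-Reasoning
  open import Algebra.Properties.Semiring.Sum semiring using (*-distribʳ-sum)
  open import Algebra.Solver.Ring.NaturalCoefficients.Default
    commutativeSemiring using (solve; _:=_; _:+_; _:*_; con)

  record Instance : Set (c ⊔ ℓ₁ ⊔ ℓ₂) where
    field
      ∣I∣ ∣J∣ : ℕ

    I : Set
    I = Fin ∣I∣

    J : Set
    J = Fin ∣J∣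

    field
      weight        : I → J → Carrier
      weight-nonneg : ∀ i j → 0# ≤ weight i j
      rate          : I → Carrier
      rate-pos      : ∀ i → 0# < rate i
      Λ             : ℕ
      {{Λ-nonZero}} : NonZero Λ
      total-rate    : sum rate ≈ fromℕ Λ

    typeProbability : I → Carrier
    typeProbability i = rate i * 1/ Λ

    Λ^-½ : Carrier
    Λ^-½ = reciprocal (√ Λ) (√-pos Λ)

    -- just j: match the arriving vertex to j; nothing: leave it unmatched
    Action : Set
    Action = Maybe J

    sumActions : (Action → Carrier) → Carrier
    sumActions f = f nothing + sum (λ j → f (just j))

    -- The types that arrived so far and the actions taken, latest first
    History : Set
    History = List (I × Action)

    _MatchedIn_ : J → History → Set
    j MatchedIn h = Any (λ d → proj₂ d ≡ just j) h

    gain : I × Action → Carrier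
    gain (i , nothing) = 0#
    gain (i , just j)  = weight i j

    matchingWeight : History → Carrier
    matchingWeight []      = 0#
    matchingWeight (d ∷ h) = gain d + matchingWeight h

    lastGain : History → Carrier
    lastGain []      = 0#
    lastGain (d ∷ h) = gain d

  -- A randomized algorithm is given by the conditional distribution of its next
  -- action given everything that happened so far. Randomness shared between
  -- different arrivals is covered: the joint law of arrivals and actions is
  -- determined by these conditional distributions.
  record Algorithm (X : Instance) : Set (c ⊔ ℓ₁ ⊔ ℓ₂) where
    open Instance X
    field
      decide          : History → I → Action → Carrier
      decide-nonneg   : ∀ h i a → 0# ≤ decide h i a
      decide-total    : ∀ h i → sumActions (decide h i) ≈ 1#
      decide-feasible : ∀ h i j → j MatchedIn h → decide h i (just j) ≈ 0#

  module _ {X : Instance} (A : Algorithm X) where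
    open Instance X
    open Algorithm A

    -- Expectation of f over the history after one more arrival
    step : (History → Carrier) → History → Carrier
    step f h = sum (λ i → typeProbability i *
      sumActions (λ a → decide h i a * f ((i , a) ∷ h)))

    -- Expectation of f over the history after n more arrivals
    𝔼 : ℕ → (History → Carrier) → History → Carrier
    𝔼 zero    f h = f h
    𝔼 (suc n) f h = step (𝔼 n f) h

    -- Expected weight obtained from the n-th arrival, for n ≥ 1
    ALG : ℕ → Carrier
    ALG n = 𝔼 n lastGain []

    Monotone : Set ℓ₂
    Monotone = ∀ n → 1 ℕ.≤ n → ALG (suc n) ≤ ALG n

    ApproximatelyMonotone : Carrier → Set ℓ₂
    ApproximatelyMonotone α = ∀ ℓ n → 1 ℕ.≤ ℓ → ℓ ℕ.< n → ALG n ≤ α * ALG ℓ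

    -- Expected weight of the matching when exactly m vertices arrive
    objective : ℕ → Carrier
    objective m = 𝔼 m matchingWeight []

    stochasticObjective : Carrier
    stochasticObjective = objective Λ

    poissonProbability : ℕ → Carrier
    poissonProbability m = exp⁻ Λ * (fromℕ Λ ^ m * 1/_ (m !) {{m ℕ.!≢0}})

    poissonTerm : ℕ → Carrier
    poissonTerm m = poissonProbability m * objective m

    typeProbability-nonneg : ∀ i → 0# ≤ typeProbability i
    typeProbability-nonneg i =
      <⇒≤ (*-pos (rate-pos i) (reciprocal-pos (fromℕ-pos Λ)))

    typeProbability-total : sum typeProbability ≈ 1#
    typeProbability-total = begin-equality
      sum (λ i → rate i * 1/ Λ)  ≈⟨ *-distribʳ-sum (1/ Λ) rate ⟨
      sum rate * 1/ Λ            ≈⟨ *-congʳ total-rate ⟩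
      fromℕ Λ * 1/ Λ             ≈⟨ reciprocal-inverseʳ (fromℕ-pos Λ) ⟩
      1#                         ∎

    sumActions-nonneg : ∀ {f} → (∀ a → 0# ≤ f a) → 0# ≤ sumActions f
    sumActions-nonneg 0≤f = +-nonneg (0≤f nothing) (sum-nonneg (λ j → 0≤f (just j)))

    step-nonneg : ∀ f h → (∀ d → 0# ≤ f (d ∷ h)) → 0# ≤ step f h
    step-nonneg f h 0≤f = sum-nonneg (λ i → *-nonneg (typeProbability-nonneg i)
      (sumActions-nonneg {λ a → decide h i a * f ((i , a) ∷ h)}
        (λ a → *-nonneg (decide-nonneg h i a) (0≤f (i , a)))))

    step-bounded : ∀ f h b → (∀ d → f (d ∷ h) ≤ b) → step f h ≤ b
    step-bounded f h b f≤b = begin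
      step f h
        ≤⟨ sum-mono (λ i → *-monoʳ-≤ (typeProbability i) (typeProbability-nonneg i) (actions-≤ i)) ⟩
      sum (λ i → typeProbability i * b)  ≈⟨ *-distribʳ-sum b typeProbability ⟨
      sum typeProbability * b            ≈⟨ *-congʳ typeProbability-total ⟩
      1# * b                             ≈⟨ *-identityˡ b ⟩
      b                                  ∎
      where
      each : ∀ i a → decide h i a * f ((i , a) ∷ h) ≤ decide h i a * b
      each i a = *-monoʳ-≤ (decide h i a) (decide-nonneg h i a) (f≤b (i , a))
      actions-≤ : ∀ i → sumActions (λ a → decide h i a * f ((i , a) ∷ h)) ≤ b
      actions-≤ i = begin
        sumActions (λ a → decide h i a * f ((i , a) ∷ h))
          ≤⟨ +-mono-≤ (each i nothing) (sum-mono (λ j → each i (just j))) ⟩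
        decide h i nothing * b + sum (λ j → decide h i (just j) * b)
          ≈⟨ +-congˡ (*-distribʳ-sum b (λ j → decide h i (just j))) ⟨
        decide h i nothing * b + sum (λ j → decide h i (just j)) * b
          ≈⟨ distribʳ b _ _ ⟨
        sumActions (decide h i) * b
          ≈⟨ *-congʳ (decide-total h i) ⟩
        1# * b
          ≈⟨ *-identityˡ b ⟩
        b ∎

    maxGain : Carrier
    maxGain = sum (λ i → sum (weight i))

    maxGain-nonneg : 0# ≤ maxGain
    maxGain-nonneg = sum-nonneg (λ i → sum-nonneg (weight-nonneg i))

    gain-nonneg : ∀ d → 0# ≤ gain d
    gain-nonneg (i , nothing) = ≤-refl
    gain-nonneg (i , just j)  = weight-nonneg i j

    gain-≤ : ∀ d → gain d ≤ maxGain
    gain-≤ (i , nothing) = maxGain-nonneg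
    gain-≤ (i , just j)  = ≤-trans (term≤sum (weight i) (weight-nonneg i) j)
      (term≤sum (λ i → sum (weight i)) (λ i → sum-nonneg (weight-nonneg i)) i)

    matchingWeight-nonneg : ∀ h → 0# ≤ matchingWeight h
    matchingWeight-nonneg []      = ≤-refl
    matchingWeight-nonneg (d ∷ h) = +-nonneg (gain-nonneg d) (matchingWeight-nonneg h)

    𝔼-nonneg : ∀ n h → 0# ≤ 𝔼 n matchingWeight h
    𝔼-nonneg zero    h = matchingWeight-nonneg h
    𝔼-nonneg (suc n) h =
      step-nonneg (𝔼 n matchingWeight) h (λ d → 𝔼-nonneg n (d ∷ h))

    𝔼-≤ : ∀ n h → 𝔼 n matchingWeight h ≤ matchingWeight h + fromℕ n * maxGain
    𝔼-≤ zero    h = x≤x+y (≤-reflexive (sym (zeroˡ maxGain)))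
    𝔼-≤ (suc n) h = step-bounded (𝔼 n matchingWeight) h _ (λ d → begin
      𝔼 n matchingWeight (d ∷ h)
        ≤⟨ 𝔼-≤ n (d ∷ h) ⟩
      gain d + matchingWeight h + fromℕ n * maxGain
        ≤⟨ +-monoˡ-≤ _ (+-monoˡ-≤ _ (gain-≤ d)) ⟩
      maxGain + matchingWeight h + fromℕ n * maxGain
        ≈⟨ solve 3 (λ g w n → g :+ w :+ n :* g := w :+ (con 1 :+ n) :* g)
             refl maxGain (matchingWeight h) (fromℕ n) ⟩
      matchingWeight h + fromℕ (suc n) * maxGain ∎)

    objective-≤ : ∀ m → objective m ≤ fromℕ m * maxGain
    objective-≤ m = ≤-trans (𝔼-≤ m []) (≤-reflexive (+-identityˡ _))

    exp⁻-nonneg : 0# ≤ exp⁻ Λ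
    exp⁻-nonneg = <⇒≤ (reciprocal-pos (exp-pos Λ))

    poissonProbability-nonneg : ∀ m → 0# ≤ poissonProbability m
    poissonProbability-nonneg m = *-nonneg exp⁻-nonneg (expTerm-nonneg Λ m)

    majorant : Carrier
    majorant = exp⁻ Λ * fromℕ Λ * maxGain

    majorant-nonneg : 0# ≤ majorant
    majorant-nonneg = *-nonneg (*-nonneg exp⁻-nonneg (fromℕ-nonneg Λ)) maxGain-nonneg

    poissonTerm-≤ : ∀ m → poissonTerm (suc m) ≤ majorant * expTerm Λ m
    poissonTerm-≤ m = begin
      poissonProbability (suc m) * objective (suc m)
        ≤⟨ *-monoʳ-≤ _ (poissonProbability-nonneg (suc m)) (objective-≤ (suc m)) ⟩
      (exp⁻ Λ * expTerm Λ (suc m)) * (fromℕ (suc m) * maxGain)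
        ≈⟨ solve 4 (λ e t s g → (e :* t) :* (s :* g) := e :* (t :* s) :* g)
             refl (exp⁻ Λ) (expTerm Λ (suc m)) (fromℕ (suc m)) maxGain ⟩
      exp⁻ Λ * (expTerm Λ (suc m) * fromℕ (suc m)) * maxGain
        ≈⟨ *-congʳ (*-congˡ (expTerm-suc Λ m)) ⟩
      exp⁻ Λ * (expTerm Λ m * fromℕ Λ) * maxGain
        ≈⟨ solve 4 (λ e t l g → e :* (t :* l) :* g := e :* l :* g :* t)
             refl (exp⁻ Λ) (expTerm Λ m) (fromℕ Λ) maxGain ⟩
      majorant * expTerm Λ m ∎

    poissonTerm-summable : Summable poissonTerm
    poissonTerm-summable = geometric-test (suc M) (majorant * expTerm Λ M)
      (*-nonneg majorant-nonneg (expTerm-nonneg Λ M))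
      (λ m → *-nonneg (poissonProbability-nonneg m) (𝔼-nonneg m []))
      (λ k → begin
        poissonTerm (suc (M ℕ.+ k))         ≤⟨ poissonTerm-≤ (M ℕ.+ k) ⟩
        majorant * expTerm Λ (M ℕ.+ k)
          ≤⟨ *-monoʳ-≤ majorant majorant-nonneg (expTerm-geometric Λ k) ⟩
        majorant * (expTerm Λ M * ½ ^ k)    ≈⟨ *-assoc _ _ _ ⟨
        majorant * expTerm Λ M * ½ ^ k      ∎)
      where M = Λ ℕ.+ Λ

    poissonObjective : Carrier
    poissonObjective = Σ∞ poissonTerm poissonTerm-summable

{-# OPTIONS --safe #-}
-- Let F m be the objective for exactly m arrivals and p the Poisson distribution
-- with mean Λ. If the increments of F are nonincreasing, then F lies below its
-- tangent F Λ + (m - Λ) ALG Λ at Λ, and m - Λ has mean 0 under p. In the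
-- approximately monotone case every increment beyond Λ is at most
-- α (F Λ / Λ), because F Λ / Λ is the average of the first Λ increments. Hence
-- F m ≤ F Λ + α (F Λ / Λ) (m - Λ)⁺, and (m - Λ)⁺ ≤ √Λ + (m - Λ)² / √Λ has mean
-- at most 2 √Λ by the variance of p. Both moments are summed up to a finite
-- bound, where an explicit boundary term of favourable sign replaces the limit.
module Submission where

open import Defs
open import Data.List.Base using ([]; _∷_)
open import Data.Maybe.Base using (just; nothing)
open import Data.Nat.Base as ℕ using (ℕ; zero; suc; ∣_-_∣)
import Data.Nat.Properties as ℕ
open import Data.Nat.Solver using (module +-*-Solver)
open import Data.Product using (_×_; ∃-syntax; _,_)
open import Data.Sum.Base using (inj₁; inj₂)
open import Relation.Binary.PropositionalEquality as ≡ using (_≡_)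

-- Squared distance of natural numbers

-- The binomial formula with the mixed term moved to the left, so that it survives the passage
-- through `fromℕ` into a semiring calculation. Lowering both arguments by one leaves the distance
-- unchanged, hence the simultaneous induction.
∣-∣-square : ∀ m n →
  ∣ m - n ∣ ℕ.* ∣ m - n ∣ ℕ.+ (m ℕ.* n ℕ.+ m ℕ.* n) ≡ m ℕ.* m ℕ.+ n ℕ.* n
∣-∣-square zero    n       = ℕ.+-identityʳ (n ℕ.* n)
∣-∣-square (suc m) zero    = ≡.cong (suc m ℕ.* suc m ℕ.+_)
  (≡.cong₂ ℕ._+_ (ℕ.*-zeroʳ m) (ℕ.*-zeroʳ m))
∣-∣-square (suc m) (suc n) = begin
  d² ℕ.+ (suc m ℕ.* suc n ℕ.+ suc m ℕ.* suc n)
    ≡⟨ solve 3 (λ d m n → d :+ ((con 1 :+ m) :* (con 1 :+ n) :+ (con 1 :+ m) :* (con 1 :+ n))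
         := (d :+ (m :* n :+ m :* n)) :+ (con 2 :+ (m :+ m) :+ (n :+ n))) ≡.refl d² m n ⟩
  d² ℕ.+ (m ℕ.* n ℕ.+ m ℕ.* n) ℕ.+ (2 ℕ.+ (m ℕ.+ m) ℕ.+ (n ℕ.+ n))
    ≡⟨ ≡.cong (ℕ._+ (2 ℕ.+ (m ℕ.+ m) ℕ.+ (n ℕ.+ n))) (∣-∣-square m n) ⟩
  m ℕ.* m ℕ.+ n ℕ.* n ℕ.+ (2 ℕ.+ (m ℕ.+ m) ℕ.+ (n ℕ.+ n))
    ≡⟨ solve 2 (λ m n → m :* m :+ n :* n :+ (con 2 :+ (m :+ m) :+ (n :+ n))
         := (con 1 :+ m) :* (con 1 :+ m) :+ (con 1 :+ n) :* (con 1 :+ n)) ≡.refl m n ⟩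
  suc m ℕ.* suc m ℕ.+ suc n ℕ.* suc n ∎
  where
  open ≡.≡-Reasoning
  open +-*-Solver using (solve; _:*_; _:+_; _:=_; con)
  d² = ∣ m - n ∣ ℕ.* ∣ m - n ∣

module _ {c ℓ₁ ℓ₂} (ℝ : Reals c ℓ₁ ℓ₂) where
  open Reals ℝ
  open RealProperties ℝ
  open ≤-Reasoning
  open import Algebra.Properties.Ring ring using (+-cancelʳ)
  open import Algebra.Properties.Semiring.Sum semiring
    using (*-distribʳ-sum; ∑-distrib-+; sum-cong-≋)
  open import Algebra.Solver.Ring.NaturalCoefficients.Default
    commutativeSemiring using (solve; _:=_; _:+_; _:*_; con)

  -- Order, nonnegative series and weighted sums

  +-cancelʳ-≤ : ∀ z {x y} → x + z ≤ y + z → x ≤ y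
  +-cancelʳ-≤ z x+z≤y+z y<x = x+z≤y+z (+-monoˡ-< z y<x)

  -- A weak inequality is a negation, so it may be proved by comparing any two
  -- reals, although the order is not decidable.
  ≤-by-cases : ∀ x y {u v} → (x ≤ y → u ≤ v) → (y ≤ x → u ≤ v) → u ≤ v
  ≤-by-cases x y f g v<u = f (λ y<x → g (<⇒≤ y<x) v<u) v<u

  partialSum-nonneg : ∀ {a} → (∀ n → 0# ≤ a n) → ∀ n → 0# ≤ partialSum a n
  partialSum-nonneg 0≤a zero    = ≤-refl
  partialSum-nonneg 0≤a (suc n) = +-nonneg (partialSum-nonneg 0≤a n) (0≤a n)

  partialSum-≤-Σ∞ : ∀ {a} (s : Summable a) → (∀ n → 0# ≤ a n) →
    ∀ n → partialSum a n ≤ Σ∞ a s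
  partialSum-≤-Σ∞ {a} s 0≤a n = limit-≥ n (Σ∞-converges a s)
    (λ m → nondecreasing-≤ {partialSum a} (λ k → x≤x+y (0≤a k)))

  -- Turns a pointwise bound into one between truncated expectations. The constant `C` stands on the
  -- left in place of a negative constant on the right: a tangent takes `C` to be `L` times its
  -- slope, a parabola takes zero.
  weighted-mono : ∀ {p f h : ℕ → Carrier} {A B C} → (∀ m → 0# ≤ p m) → (∀ m → f m + C ≤ A + B * h m) →
    ∀ N → partialSum (λ m → p m * f m) N + C * partialSum p N
        ≤ A * partialSum p N + B * partialSum (λ m → p m * h m) N
  weighted-mono {A = A} {B} {C} 0≤p f≤ zero = ≤-reflexive
    (solve 3 (λ a b c → con 0 :+ c :* con 0 := a :* con 0 :+ b :* con 0) refl A B C)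
  weighted-mono {p} {f} {h} {A} {B} {C} 0≤p f≤ (suc N) = begin
    (F + p N * f N) + C * (S + p N)
      ≈⟨ solve 5 (λ F p f c S → (F :+ p :* f) :+ c :* (S :+ p) := (F :+ c :* S) :+ p :* (f :+ c))
           refl F (p N) (f N) C S ⟩
    (F + C * S) + p N * (f N + C)
      ≤⟨ +-mono-≤ (weighted-mono {p} {f} {h} 0≤p f≤ N) (*-monoʳ-≤ (p N) (0≤p N) (f≤ N)) ⟩
    (A * S + B * H) + p N * (A + B * h N)
      ≈⟨ solve 6 (λ a S b H p h → (a :* S :+ b :* H) :+ p :* (a :+ b :* h)
           := a :* (S :+ p) :+ b :* (H :+ p :* h)) refl A S B H (p N) (h N) ⟩
    A * (S + p N) + B * (H + p N * h N) ∎
    where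
    F = partialSum (λ m → p m * f m) N
    H = partialSum (λ m → p m * h m) N
    S = partialSum p N

  -- From t ≤ s one gets t ≤ s, and from s ≤ t one gets t = r s t ≤ r t².
  ≤-scaled-square : ∀ {r s t} → 0# ≤ r → 0# ≤ s → 0# ≤ t → r * s ≈ 1# → t ≤ s + r * (t * t)
  ≤-scaled-square {r} {s} {t} 0≤r 0≤s 0≤t rs≈1 = ≤-by-cases t s
    (λ t≤s → ≤-trans t≤s (x≤x+y (*-nonneg 0≤r (*-nonneg 0≤t 0≤t))))
    (λ s≤t → begin
      t                ≈⟨ *-identityˡ t ⟨
      1# * t           ≈⟨ *-congʳ rs≈1 ⟨
      r * s * t        ≈⟨ *-assoc r s t ⟩
      r * (s * t)      ≤⟨ *-monoʳ-≤ r 0≤r (*-monoˡ-≤ t 0≤t s≤t) ⟩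
      r * (t * t)      ≤⟨ x≤x+y 0≤s ⟩
      r * (t * t) + s  ≈⟨ +-comm _ _ ⟩
      s + r * (t * t)  ∎)

  -- Sequences with bounded increments

  module Increments {F g : ℕ → Carrier} (F-suc : ∀ m → F (suc m) ≈ F m + g m) where

    growth-≤ : ∀ m k a → (∀ i → m ℕ.≤ i → g i ≤ a) → F (m ℕ.+ k) ≤ F m + fromℕ k * a
    growth-≤ m zero a g≤a = begin
      F (m ℕ.+ 0)   ≡⟨ ≡.cong F (ℕ.+-identityʳ m) ⟩
      F m           ≈⟨ solve 2 (λ x a → x := x :+ con 0 :* a) refl (F m) a ⟩
      F m + 0# * a  ∎
    growth-≤ m (suc k) a g≤a = begin
      F (m ℕ.+ suc k)              ≡⟨ ≡.cong F (ℕ.+-suc m k) ⟩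
      F (suc (m ℕ.+ k))            ≈⟨ F-suc (m ℕ.+ k) ⟩
      F (m ℕ.+ k) + g (m ℕ.+ k)    ≤⟨ +-mono-≤ (growth-≤ m k a g≤a) (g≤a _ (ℕ.m≤m+n m k)) ⟩
      F m + fromℕ k * a + a
        ≈⟨ solve 3 (λ x k a → x :+ k :* a :+ a := x :+ (con 1 :+ k) :* a) refl (F m) (fromℕ k) a ⟩
      F m + fromℕ (suc k) * a      ∎

    growth-≥ : ∀ m k a → (∀ i → i ℕ.< m ℕ.+ k → a ≤ g i) → F m + fromℕ k * a ≤ F (m ℕ.+ k)
    growth-≥ m zero a a≤g = begin
      F m + 0# * a  ≈⟨ solve 2 (λ x a → x := x :+ con 0 :* a) refl (F m) a ⟨
      F m           ≡⟨ ≡.cong F (ℕ.+-identityʳ m) ⟨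
      F (m ℕ.+ 0)   ∎
    growth-≥ m (suc k) a a≤g = begin
      F m + fromℕ (suc k) * a
        ≈⟨ solve 3 (λ x k a → x :+ k :* a :+ a := x :+ (con 1 :+ k) :* a) refl (F m) (fromℕ k) a ⟨
      F m + fromℕ k * a + a
        ≤⟨ +-mono-≤ (growth-≥ m k a (λ i i< → a≤g i (ℕ.<-≤-trans i< (ℕ.+-monoʳ-≤ m (ℕ.n≤1+n k)))))
             (a≤g (m ℕ.+ k) (ℕ.+-monoʳ-< m (ℕ.n<1+n k))) ⟩
      F (m ℕ.+ k) + g (m ℕ.+ k)    ≈⟨ F-suc (m ℕ.+ k) ⟨
      F (suc (m ℕ.+ k))            ≡⟨ ≡.cong F (ℕ.+-suc m k) ⟨
      F (m ℕ.+ suc k)              ∎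

    -- F m ≤ F L + (m - L) a, without subtraction.
    below-tangent : ∀ L a → (∀ i → i ℕ.< L → a ≤ g i) → (∀ i → L ℕ.≤ i → g i ≤ a) →
      ∀ m → F m + fromℕ L * a ≤ F L + fromℕ m * a
    below-tangent L a a≤g g≤a m with ℕ.≤-total m L
    ... | inj₂ L≤m with ℕ.m≤n⇒∃[o]m+o≡n L≤m
    ...   | k , ≡.refl = begin
      F (L ℕ.+ k) + fromℕ L * a          ≤⟨ +-monoˡ-≤ _ (growth-≤ L k a g≤a) ⟩
      F L + fromℕ k * a + fromℕ L * a
        ≈⟨ solve 4 (λ x k l a → x :+ k :* a :+ l :* a := x :+ (l :+ k) :* a)
             refl (F L) (fromℕ k) (fromℕ L) a ⟩
      F L + (fromℕ L + fromℕ k) * a      ≈⟨ +-congˡ (*-congʳ (fromℕ-+ L k)) ⟨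
      F L + fromℕ (L ℕ.+ k) * a          ∎
    below-tangent L a a≤g g≤a m | inj₁ m≤L with ℕ.m≤n⇒∃[o]m+o≡n m≤L
    ...   | k , ≡.refl = begin
      F m + fromℕ (m ℕ.+ k) * a          ≈⟨ +-congˡ (*-congʳ (fromℕ-+ m k)) ⟩
      F m + (fromℕ m + fromℕ k) * a
        ≈⟨ solve 4 (λ x k l a → x :+ k :* a :+ l :* a := x :+ (l :+ k) :* a)
             refl (F m) (fromℕ k) (fromℕ m) a ⟨
      F m + fromℕ k * a + fromℕ m * a    ≤⟨ +-monoˡ-≤ _ (growth-≥ m k a a≤g) ⟩
      F (m ℕ.+ k) + fromℕ m * a          ∎

    -- Up to `L` nonnegative increments keep `F m` below `F L`, and beyond `L` each step adds at
    -- most `b`. The two-sided distance replaces the positive part of `m - L` because its square is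
    -- what the variance sums.
    below-cone : ∀ L b → 0# ≤ b → (∀ i → 0# ≤ g i) → (∀ i → L ℕ.≤ i → g i ≤ b) →
      ∀ m → F m ≤ F L + b * fromℕ ∣ m - L ∣
    below-cone L b 0≤b 0≤g g≤b m with ℕ.≤-total m L
    ... | inj₁ m≤L = begin
      F m    ≤⟨ nondecreasing-≤ {F} (λ n → ≤-trans (x≤x+y (0≤g n))
                  (≤-reflexive (sym (F-suc n)))) m≤L ⟩
      F L    ≤⟨ x≤x+y (*-nonneg 0≤b (fromℕ-nonneg ∣ m - L ∣)) ⟩
      F L + b * fromℕ ∣ m - L ∣ ∎
    ... | inj₂ L≤m with ℕ.m≤n⇒∃[o]m+o≡n L≤m
    ...   | k , ≡.refl = begin
      F (L ℕ.+ k)        ≤⟨ growth-≤ L k b g≤b ⟩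
      F L + fromℕ k * b  ≈⟨ +-congˡ (*-comm (fromℕ k) b) ⟩
      F L + b * fromℕ k
        ≡⟨ ≡.cong (λ t → F L + b * fromℕ t) (≡.trans (ℕ.∣-∣-comm (L ℕ.+ k) L) (ℕ.∣m-m+n∣≡n L k)) ⟨
      F L + b * fromℕ ∣ L ℕ.+ k - L ∣ ∎

  -- Truncated moments from the Poisson recursion

  module PoissonMoments (L : ℕ) (p : ℕ → Carrier) (p-nonneg : ∀ m → 0# ≤ p m)
    (p-suc : ∀ m → fromℕ (suc m) * p (suc m) ≈ fromℕ L * p m)
    (mass-≤1 : ∀ N → partialSum p N ≤ 1#) where

    mass mean variance : ℕ → Carrier
    mass     = partialSum p
    mean     = partialSum (λ m → p m * fromℕ m)
    variance = partialSum (λ m → p m * fromℕ (∣ m - L ∣ ℕ.* ∣ m - L ∣))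

    -- By `p-suc` the term of the mean at `m + 1` is `L * p m`, so the mean is `L` times the mass
    -- with the index shifted by one. The boundary term is what the shift leaves out.
    mean-truncated : ∀ N → mean N + fromℕ N * p N ≈ fromℕ L * mass N
    mean-truncated zero    = solve 2 (λ p l → con 0 :+ con 0 :* p := l :* con 0) refl (p 0) (fromℕ L)
    mean-truncated (suc N) = begin-equality
      (mean N + p N * n) + fromℕ (suc N) * p (suc N)
        ≈⟨ +-cong (+-congˡ (*-comm (p N) n)) (p-suc N) ⟩
      (mean N + n * p N) + l * p N  ≈⟨ +-congʳ (mean-truncated N) ⟩
      l * mass N + l * p N          ≈⟨ distribˡ l (mass N) (p N) ⟨
      l * mass (suc N)              ∎
      where
      n = fromℕ N
      l = fromℕ L

    -- variance N + N (N - L) p N = L · mass N, without subtraction.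
    variance-truncated : ∀ N → variance N + fromℕ N * (fromℕ N * p N)
      ≈ fromℕ L * mass N + fromℕ L * (fromℕ N * p N)
    variance-truncated zero = solve 2
      (λ p l → con 0 :+ con 0 :* (con 0 :* p) := l :* con 0 :+ l :* (con 0 :* p))
      refl (p 0) (fromℕ L)
    -- The mixed term `l * (n * q)` is added on both sides so that `square` can replace the squared
    -- distance without subtracting.
    variance-truncated (suc N) = +-cancelʳ (l * (n * q)) _ _ (begin-equality
      (variance N + q * v) + fromℕ (suc N) * (fromℕ (suc N) * p (suc N)) + l * (n * q)
        ≈⟨ +-congʳ (+-congˡ (*-congˡ (p-suc N))) ⟩
      (variance N + q * v) + (1# + n) * (l * q) + l * (n * q)
        ≈⟨ solve 5 (λ V q v n l → (V :+ q :* v) :+ (con 1 :+ n) :* (l :* q) :+ l :* (n :* q)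
             := V :+ l :* q :+ q :* (v :+ (n :* l :+ n :* l))) refl (variance N) q v n l ⟩
      variance N + l * q + q * (v + (n * l + n * l))
        ≈⟨ +-congˡ (*-congˡ square) ⟩
      variance N + l * q + q * (n * n + l * l)
        ≈⟨ solve 4 (λ V q n l → V :+ l :* q :+ q :* (n :* n :+ l :* l)
             := (V :+ n :* (n :* q)) :+ (l :* q :+ l :* (l :* q))) refl (variance N) q n l ⟩
      (variance N + n * (n * q)) + (l * q + l * (l * q))
        ≈⟨ +-congʳ (variance-truncated N) ⟩
      (l * mass N + l * (n * q)) + (l * q + l * (l * q))
        ≈⟨ solve 4 (λ S q n l → (l :* S :+ l :* (n :* q)) :+ (l :* q :+ l :* (l :* q))
             := l :* (S :+ q) :+ l :* (l :* q) :+ l :* (n :* q)) refl (mass N) q n l ⟩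
      l * mass (suc N) + l * (l * q) + l * (n * q)
        ≈⟨ +-congʳ (+-congˡ (*-congˡ (p-suc N))) ⟨
      l * mass (suc N) + l * (fromℕ (suc N) * p (suc N)) + l * (n * q) ∎)
      where
      n = fromℕ N
      l = fromℕ L
      q = p N
      v = fromℕ (∣ N - L ∣ ℕ.* ∣ N - L ∣)
      square : v + (n * l + n * l) ≈ n * n + l * l
      square = begin-equality
        v + (n * l + n * l)
          ≈⟨ +-congˡ (+-cong (fromℕ-* N L) (fromℕ-* N L)) ⟨
        v + (fromℕ (N ℕ.* L) + fromℕ (N ℕ.* L))
          ≈⟨ +-congˡ (fromℕ-+ (N ℕ.* L) (N ℕ.* L)) ⟨
        v + fromℕ (N ℕ.* L ℕ.+ N ℕ.* L)
          ≈⟨ fromℕ-+ (∣ N - L ∣ ℕ.* ∣ N - L ∣) (N ℕ.* L ℕ.+ N ℕ.* L) ⟨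
        fromℕ (∣ N - L ∣ ℕ.* ∣ N - L ∣ ℕ.+ (N ℕ.* L ℕ.+ N ℕ.* L))
          ≡⟨ ≡.cong fromℕ (∣-∣-square N L) ⟩
        fromℕ (N ℕ.* N ℕ.+ L ℕ.* L)
          ≈⟨ fromℕ-+ (N ℕ.* N) (L ℕ.* L) ⟩
        fromℕ (N ℕ.* N) + fromℕ (L ℕ.* L)
          ≈⟨ +-cong (fromℕ-* N N) (fromℕ-* L L) ⟩
        n * n + l * l ∎

    mean-≤ : ∀ N → mean N ≤ fromℕ L * mass N
    mean-≤ N = ≤-trans (x≤x+y (*-nonneg (fromℕ-nonneg N) (p-nonneg N)))
      (≤-reflexive (mean-truncated N))

    variance-≤ : ∀ N → L ℕ.≤ N → variance N ≤ fromℕ L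
    variance-≤ N L≤N = +-cancelʳ-≤ (fromℕ N * (fromℕ N * p N)) (begin
      variance N + fromℕ N * (fromℕ N * p N)
        ≈⟨ variance-truncated N ⟩
      fromℕ L * mass N + fromℕ L * (fromℕ N * p N)
        ≤⟨ +-mono-≤ (*-monoʳ-≤ _ (fromℕ-nonneg L) (mass-≤1 N))
             (*-monoˡ-≤ _ (*-nonneg (fromℕ-nonneg N) (p-nonneg N)) (fromℕ-mono-≤ L≤N)) ⟩
      fromℕ L * 1# + fromℕ N * (fromℕ N * p N)
        ≈⟨ +-congʳ (*-identityʳ _) ⟩
      fromℕ L + fromℕ N * (fromℕ N * p N) ∎)

    -- The linear parts cancel, since `mean N` is at most `L` times `mass N` at every truncation.
    -- For the constant part, `0# ≤ A` makes mass at most one sufficient.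
    expectation-≤-tangent : ∀ {f A a} → 0# ≤ A → 0# ≤ a →
      (∀ m → f m + fromℕ L * a ≤ A + fromℕ m * a) → ∀ N → partialSum (λ m → p m * f m) N ≤ A
    expectation-≤-tangent {f} {A} {a} 0≤A 0≤a f≤ N = +-cancelʳ-≤ (l * a * mass N) (begin
      partialSum (λ m → p m * f m) N + l * a * mass N
        ≤⟨ weighted-mono {p} {f} {fromℕ} p-nonneg
             (λ m → ≤-trans (f≤ m) (≤-reflexive (+-congˡ (*-comm (fromℕ m) a)))) N ⟩
      A * mass N + a * mean N
        ≤⟨ +-mono-≤ (*-monoʳ-≤ A 0≤A (mass-≤1 N)) (*-monoʳ-≤ a 0≤a (mean-≤ N)) ⟩
      A * 1# + a * (l * mass N)
        ≈⟨ solve 4 (λ A a l S → A :* con 1 :+ a :* (l :* S) := A :+ l :* a :* S)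
             refl A a l (mass N) ⟩
      A + l * a * mass N ∎)
      where l = fromℕ L

    expectation-≤-parabola : ∀ {f A B} → 0# ≤ A → 0# ≤ B →
      (∀ m → f m ≤ A + B * fromℕ (∣ m - L ∣ ℕ.* ∣ m - L ∣)) →
      ∀ N → L ℕ.≤ N → partialSum (λ m → p m * f m) N ≤ A + B * fromℕ L
    expectation-≤-parabola {f} {A} {B} 0≤A 0≤B f≤ N L≤N = begin
      E                        ≈⟨ solve 2 (λ E S → E := E :+ con 0 :* S) refl E (mass N) ⟩
      E + 0# * mass N
        ≤⟨ weighted-mono {p} {f} p-nonneg
             (λ m → ≤-trans (≤-reflexive (+-identityʳ (f m))) (f≤ m)) N ⟩
      A * mass N + B * variance N
        ≤⟨ +-mono-≤ (*-monoʳ-≤ A 0≤A (mass-≤1 N)) (*-monoʳ-≤ B 0≤B (variance-≤ N L≤N)) ⟩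
      A * 1# + B * fromℕ L     ≈⟨ +-congʳ (*-identityʳ A) ⟩
      A + B * fromℕ L          ∎
      where E = partialSum (λ m → p m * f m) N

  -- The Poisson distribution

  module Poisson (L : ℕ) where

    -- For `L` equal to `Λ` this unfolds to `poissonProbability`, so bounds on its truncated
    -- expectations are bounds on partial sums of `poissonTerm`.
    p : ℕ → Carrier
    p m = exp⁻ L * expTerm L m

    exp⁻-nonneg : 0# ≤ exp⁻ L
    exp⁻-nonneg = <⇒≤ (reciprocal-pos {exp L} (exp-pos L))

    p-nonneg : ∀ m → 0# ≤ p m
    p-nonneg m = *-nonneg {exp⁻ L} {expTerm L m} exp⁻-nonneg (expTerm-nonneg L m)

    p-suc : ∀ m → fromℕ (suc m) * p (suc m) ≈ fromℕ L * p m
    p-suc m = suc-identity (exp⁻ L) (fromℕ (suc m)) (expTerm L (suc m)) (expTerm L m) (fromℕ L)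
      (expTerm-suc L m)
      where
      suc-identity : ∀ e n t u l → t * n ≈ u * l → n * (e * t) ≈ l * (e * u)
      suc-identity e n t u l tn≈ul = begin-equality
        n * (e * t)  ≈⟨ solve 3 (λ n e t → n :* (e :* t) := e :* (t :* n)) refl n e t ⟩
        e * (t * n)  ≈⟨ *-congˡ tn≈ul ⟩
        e * (u * l)  ≈⟨ solve 3 (λ n e t → n :* (e :* t) := e :* (t :* n)) refl l e u ⟨
        l * (e * u)  ∎

    mass-≤1 : ∀ N → partialSum p N ≤ 1#
    mass-≤1 = scaled-≤1 (exp⁻ L) (exp L) (expTerm L) exp⁻-nonneg
      (partialSum-≤-Σ∞ (expTerm-summable L) (expTerm-nonneg L))
      (reciprocal-inverseʳ {exp L} (exp-pos L))
      where
      partialSum-scaled : ∀ e a N → partialSum (λ m → e * a m) N ≈ e * partialSum a N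
      partialSum-scaled e a zero    = sym (zeroʳ e)
      partialSum-scaled e a (suc N) =
        trans (+-congʳ (partialSum-scaled e a N)) (sym (distribˡ e _ _))
      scaled-≤1 : ∀ e E a → 0# ≤ e → (∀ N → partialSum a N ≤ E) → E * e ≈ 1# →
        ∀ N → partialSum (λ m → e * a m) N ≤ 1#
      scaled-≤1 e E a 0≤e a≤E Ee≈1 N = begin
        partialSum (λ m → e * a m) N  ≈⟨ partialSum-scaled e a N ⟩
        e * partialSum a N            ≤⟨ *-monoʳ-≤ e 0≤e (a≤E N) ⟩
        e * E                         ≈⟨ *-comm e E ⟩
        E * e                         ≈⟨ Ee≈1 ⟩
        1#                            ∎

    open PoissonMoments L p p-nonneg p-suc mass-≤1 public
      using (expectation-≤-tangent; expectation-≤-parabola)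

  open OnlineMatching ℝ

  -- The objective as a sum of expected gains

  module _ {X : Instance} (A : Algorithm X) where
    open Instance X
    open Algorithm A

    step-cong : ∀ f g h → (∀ d → f (d ∷ h) ≈ g (d ∷ h)) → step A f h ≈ step A g h
    step-cong f g h f≈g = sum-cong-≋ (λ i → *-congˡ {x = typeProbability i}
      (+-cong (*-congˡ (f≈g (i , nothing)))
        (sum-cong-≋ (λ j → *-congˡ {x = decide h i (just j)} (f≈g (i , just j))))))

    step-+ : ∀ f g h → step A (λ h′ → f h′ + g h′) h ≈ step A f h + step A g h
    step-+ f g h = begin-equality
      step A (λ h′ → f h′ + g h′) h
        ≈⟨ sum-cong-≋ (λ i → trans (*-congˡ (actions i)) (distribˡ (typeProbability i) _ _)) ⟩
      sum (λ i → typeProbability i * actionsOf f i + typeProbability i * actionsOf g i)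
        ≈⟨ ∑-distrib-+ (λ i → typeProbability i * actionsOf f i)
             (λ i → typeProbability i * actionsOf g i) ⟩
      step A f h + step A g h ∎
      where
      actionsOf : (History → Carrier) → I → Carrier
      actionsOf f i = sumActions (λ a → decide h i a * f ((i , a) ∷ h))
      actions : ∀ i → actionsOf (λ h′ → f h′ + g h′) i ≈ actionsOf f i + actionsOf g i
      actions i = begin-equality
        d nothing * (f (k nothing) + g (k nothing)) + sum (λ j → d (just j) * (f (k (just j)) + g (k (just j))))
          ≈⟨ +-cong (distribˡ _ _ _) (trans (sum-cong-≋ (λ j → distribˡ (d (just j)) _ _))
               (∑-distrib-+ (λ j → d (just j) * f (k (just j))) (λ j → d (just j) * g (k (just j))))) ⟩
        (d nothing * f (k nothing) + d nothing * g (k nothing)) +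
          (sum (λ j → d (just j) * f (k (just j))) + sum (λ j → d (just j) * g (k (just j))))
          ≈⟨ solve 4 (λ a b c d → (a :+ b) :+ (c :+ d) := (a :+ c) :+ (b :+ d)) refl _ _ _ _ ⟩
        actionsOf f i + actionsOf g i ∎
        where
        d : Action → Carrier
        d = decide h i
        k : Action → History
        k a = (i , a) ∷ h

    step-const : ∀ b h → step A (λ _ → b) h ≈ b
    step-const b h = begin-equality
      step A (λ _ → b) h
        ≈⟨ sum-cong-≋ (λ i → *-congˡ {x = typeProbability i} (actions i)) ⟩
      sum (λ i → typeProbability i * b)  ≈⟨ *-distribʳ-sum b (typeProbability) ⟨
      sum (typeProbability) * b          ≈⟨ *-congʳ (typeProbability-total A) ⟩
      1# * b                               ≈⟨ *-identityˡ b ⟩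
      b                                    ∎
      where
      actions : ∀ i → sumActions (λ a → decide h i a * b) ≈ b
      actions i = begin-equality
        sumActions (λ a → decide h i a * b)
          ≈⟨ +-congˡ (*-distribʳ-sum b (λ j → decide h i (just j))) ⟨
        decide h i nothing * b + sum (λ j → decide h i (just j)) * b
          ≈⟨ distribʳ b _ _ ⟨
        sumActions (decide h i) * b   ≈⟨ *-congʳ (decide-total h i) ⟩
        1# * b                        ≈⟨ *-identityˡ b ⟩
        b                             ∎

    -- With one arrival left, the weight already collected is a constant under `step`. With more,
    -- condition on the first of them and use linearity; this extends the history, so `h` must be
    -- arbitrary.
    𝔼-matchingWeight-suc : ∀ n h →
      𝔼 A (suc n) matchingWeight h ≈ 𝔼 A n matchingWeight h + 𝔼 A (suc n) lastGain h
    𝔼-matchingWeight-suc zero h = begin-equality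
      step A matchingWeight h
        ≈⟨ step-cong matchingWeight (λ h′ → matchingWeight h + lastGain h′) h
             (λ d → +-comm (gain d) (matchingWeight h)) ⟩
      step A (λ h′ → matchingWeight h + lastGain h′) h
        ≈⟨ step-+ (λ _ → matchingWeight h) lastGain h ⟩
      step A (λ _ → matchingWeight h) h + step A lastGain h
        ≈⟨ +-congʳ (step-const (matchingWeight h) h) ⟩
      matchingWeight h + step A lastGain h ∎
    𝔼-matchingWeight-suc (suc n) h = trans
      (step-cong (𝔼 A (suc n) matchingWeight)
        (λ h′ → 𝔼 A n matchingWeight h′ + 𝔼 A (suc n) lastGain h′) h
        (λ d → 𝔼-matchingWeight-suc n (d ∷ h)))
      (step-+ (𝔼 A n matchingWeight) (𝔼 A (suc n) lastGain) h)

    objective-suc : ∀ m → objective A (suc m) ≈ objective A m + ALG A (suc m)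
    objective-suc m = 𝔼-matchingWeight-suc m []

    lastGain-nonneg : ∀ h → 0# ≤ lastGain h
    lastGain-nonneg []      = ≤-refl
    lastGain-nonneg (d ∷ h) = gain-nonneg A d

    𝔼-lastGain-nonneg : ∀ n h → 0# ≤ 𝔼 A n lastGain h
    𝔼-lastGain-nonneg zero    h = lastGain-nonneg h
    𝔼-lastGain-nonneg (suc n) h =
      step-nonneg A (𝔼 A n lastGain) h (λ d → 𝔼-lastGain-nonneg n (d ∷ h))

    ALG-nonneg : ∀ n → 0# ≤ ALG A n
    ALG-nonneg n = 𝔼-lastGain-nonneg n []

    objective-nonneg : ∀ m → 0# ≤ objective A m
    objective-nonneg m = 𝔼-nonneg A m []

    poissonObjective-nonneg : 0# ≤ poissonObjective A
    poissonObjective-nonneg = partialSum-≤-Σ∞ (poissonTerm-summable A)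
      (λ m → *-nonneg (poissonProbability-nonneg A m) (objective-nonneg m)) 0

    poissonObjective-≤ : ∀ {b} N → (∀ n → N ℕ.≤ n → partialSum (poissonTerm A) n ≤ b) →
      poissonObjective A ≤ b
    poissonObjective-≤ N = limit-≤ N (Σ∞-converges (poissonTerm A) (poissonTerm-summable A))

    -- The increment at `m` is the expected gain from arrival `m + 1`.
    open Increments {objective A} {λ m → ALG A (suc m)} objective-suc

    ALG-antitone : Monotone A → ∀ {m n} → 1 ℕ.≤ m → m ℕ.≤ n → ALG A n ≤ ALG A m
    ALG-antitone mono {suc m} {suc n} _ (ℕ.s≤s m≤n) =
      nonincreasing-≤ {λ k → ALG A (suc k)} (λ k → mono (suc k) (ℕ.s≤s ℕ.z≤n)) m≤n

    -- The monotone case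

    monotone⇒poisson≤stochastic : Monotone A → poissonObjective A ≤ stochasticObjective A
    monotone⇒poisson≤stochastic mono = poissonObjective-≤ 0 (λ N _ →
      Poisson.expectation-≤-tangent Λ {objective A} (objective-nonneg Λ) (ALG-nonneg Λ)
        -- The slope is the last increment before `Λ`: earlier increments are at least as large, and
        -- those from `Λ` on are at most as large.
        (below-tangent Λ (ALG A Λ)
          (λ i i<Λ → ALG-antitone mono (ℕ.s≤s ℕ.z≤n) i<Λ)
          (λ i Λ≤i → ALG-antitone mono (ℕ.>-nonZero⁻¹ Λ) (ℕ.m≤n⇒m≤1+n Λ≤i))) N)

    -- The approximately monotone case

    -- Sums the bounds `ALG A (suc n) ≤ α * ALG A ℓ` over `ℓ` from 1 to `k`. Taking `k` to be `Λ`
    -- compares a late gain with the average of the first `Λ`.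
    later-≤-average : ∀ {α} → ApproximatelyMonotone A α → ∀ n k → k ℕ.≤ n →
      fromℕ k * ALG A (suc n) ≤ α * objective A k
    later-≤-average {α} approx n zero _ = ≤-reflexive (trans (zeroˡ _) (sym (zeroʳ α)))
    later-≤-average {α} approx n (suc k) k<n = begin
      (1# + fromℕ k) * ALG A (suc n)
        ≈⟨ solve 2 (λ k a → (con 1 :+ k) :* a := k :* a :+ a) refl (fromℕ k) (ALG A (suc n)) ⟩
      fromℕ k * ALG A (suc n) + ALG A (suc n)
        ≤⟨ +-mono-≤ (later-≤-average approx n k (ℕ.<⇒≤ k<n))
             (approx (suc k) (suc n) (ℕ.s≤s ℕ.z≤n) (ℕ.s≤s k<n)) ⟩
      α * objective A k + α * ALG A (suc k)  ≈⟨ distribˡ α _ _ ⟨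
      α * (objective A k + ALG A (suc k))    ≈⟨ *-congˡ (objective-suc k) ⟨
      α * objective A (suc k)                ∎

    module _ {α} (0≤α : 0# ≤ α) (approx : ApproximatelyMonotone A α) where
      private
        r s F b x : Carrier
        r = Λ^-½
        s = √ Λ
        F = stochasticObjective A
        -- α times the average F / Λ of the first Λ increments
        b = r * r * (α * F)
        -- The relative loss: `b * s` and `b * r * fromℕ Λ` both equal `α * r * F`, hence the factor
        -- two.
        x = (1# + 1#) * α * r

        0≤r : 0# ≤ r
        0≤r = <⇒≤ (reciprocal-pos (√-pos Λ))

        rs≈1 : r * s ≈ 1#
        rs≈1 = trans (*-comm r s) (reciprocal-inverseʳ (√-pos Λ))

        0≤F : 0# ≤ F
        0≤F = objective-nonneg Λ

        0≤b : 0# ≤ b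
        0≤b = *-nonneg (*-nonneg 0≤r 0≤r) (*-nonneg 0≤α 0≤F)

        0≤x : 0# ≤ x
        0≤x = *-nonneg (*-nonneg (+-nonneg 0≤1 0≤1) 0≤α) 0≤r

        late-≤ : ∀ i → Λ ℕ.≤ i → ALG A (suc i) ≤ b
        late-≤ i Λ≤i = begin
          a                        ≈⟨ trans (*-congʳ (trans (*-cong rs≈1 rs≈1) (*-identityˡ 1#))) (*-identityˡ a) ⟨
          -- Writing one as the square of `r * s` produces `s * s`, which is `Λ`, so that the
          -- averaged bound applies without a division.
          (r * s) * (r * s) * a
            ≈⟨ solve 3 (λ r s a → (r :* s) :* (r :* s) :* a := r :* r :* (s :* s :* a)) refl r s a ⟩
          r * r * (s * s * a)      ≈⟨ *-congˡ (*-congʳ (√-square Λ)) ⟩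
          r * r * (fromℕ Λ * a)
            ≤⟨ *-monoʳ-≤ (r * r) (*-nonneg 0≤r 0≤r) (later-≤-average approx i Λ Λ≤i) ⟩
          b                        ∎
          where a = ALG A (suc i)

        -- The cone becomes a parabola because the variance controls the mean of the latter. The
        -- scale `√ Λ` balances the constant term against the quadratic one, whose mean is at most
        -- `b * r * fromℕ Λ`.
        below-parabola : ∀ m →
          objective A m ≤ (F + b * s) + b * r * fromℕ (∣ m - Λ ∣ ℕ.* ∣ m - Λ ∣)
        below-parabola m = begin
          objective A m
            ≤⟨ below-cone Λ b 0≤b (λ i → ALG-nonneg (suc i)) late-≤ m ⟩
          F + b * t
            ≤⟨ +-monoʳ-≤ F (*-monoʳ-≤ b 0≤b
                 (≤-scaled-square 0≤r (√-nonneg Λ) (fromℕ-nonneg ∣ m - Λ ∣) rs≈1)) ⟩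
          F + b * (s + r * (t * t))
            ≈⟨ solve 5 (λ F b s r q → F :+ b :* (s :+ r :* q) := (F :+ b :* s) :+ b :* r :* q)
                 refl F b s r (t * t) ⟩
          (F + b * s) + b * r * (t * t)
            ≈⟨ +-congˡ (*-congˡ (fromℕ-* ∣ m - Λ ∣ ∣ m - Λ ∣)) ⟨
          (F + b * s) + b * r * fromℕ (∣ m - Λ ∣ ℕ.* ∣ m - Λ ∣) ∎
          where t = fromℕ ∣ m - Λ ∣

        bound≈ : (F + b * s) + b * r * fromℕ Λ ≈ F + x * F
        bound≈ = begin-equality
          (F + b * s) + b * r * fromℕ Λ
            ≈⟨ +-congˡ (*-congˡ (√-square Λ)) ⟨
          (F + b * s) + b * r * (s * s)
            ≈⟨ solve 4 (λ F r s a → (F :+ r :* r :* (a :* F) :* s) :+ r :* r :* (a :* F) :* r :* (s :* s)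
                 := F :+ r :* a :* F :* (r :* s) :+ r :* a :* F :* ((r :* s) :* (r :* s)))
                 refl F r s α ⟩
          F + r * α * F * (r * s) + r * α * F * ((r * s) * (r * s))
            ≈⟨ +-cong (+-congˡ (*-congˡ rs≈1)) (*-congˡ (*-cong rs≈1 rs≈1)) ⟩
          F + r * α * F * 1# + r * α * F * (1# * 1#)
            ≈⟨ solve 3 (λ F r a → F :+ r :* a :* F :* con 1 :+ r :* a :* F :* (con 1 :* con 1)
                 := F :+ (con 1 :+ con 1) :* a :* r :* F) refl F r α ⟩
          F + x * F ∎

        P≤F+xF : poissonObjective A ≤ F + x * F
        P≤F+xF = poissonObjective-≤ Λ (λ N Λ≤N → ≤-trans
          (Poisson.expectation-≤-parabola Λ {objective A}
            (+-nonneg 0≤F (*-nonneg 0≤b (√-nonneg Λ))) (*-nonneg 0≤b 0≤r) below-parabola N Λ≤N)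
          (≤-reflexive bound≈))

      -- The sign of `1# - x` is unknown, so `P ≤ F + x * F` is not multiplied by it. Instead
      -- `P ≤ F + x * P` is shown: if `F ≤ P`, enlarge `x * F` to `x * P`; if `P ≤ F`, the added
      -- term is nonnegative.
      approximatelyMonotone⇒poisson≤stochastic :
        (1# - x) * poissonObjective A ≤ stochasticObjective A
      approximatelyMonotone⇒poisson≤stochastic = +-cancelʳ-≤ (x * P) (begin
        (1# - x) * P + x * P  ≈⟨ distribʳ P (1# - x) x ⟨
        ((1# - x) + x) * P    ≈⟨ *-congʳ (x-y+y≈x 1# x) ⟩
        1# * P                ≈⟨ *-identityˡ P ⟩
        P
          ≤⟨ ≤-by-cases F P
               (λ F≤P → ≤-trans P≤F+xF (+-monoʳ-≤ F (*-monoʳ-≤ x 0≤x F≤P)))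
               (λ P≤F → ≤-trans P≤F (x≤x+y (*-nonneg 0≤x poissonObjective-nonneg))) ⟩
        F + x * P             ∎)
        where P = poissonObjective A

theorem2 : ∀ {c ℓ₁ ℓ₂} (ℝ : Reals c ℓ₁ ℓ₂) →
    let open Reals ℝ
        open OnlineMatching ℝ
    in
    (∀ (X : Instance) (A : Algorithm X) → Monotone A →
       poissonObjective A ≤ stochasticObjective A)
    ×
    (∃[ C ] (0# < C ×
       (∀ (X : Instance) (α : Carrier) → 0# < α →
        ∀ (A : Algorithm X) → ApproximatelyMonotone A α →
        (1# - C * α * Instance.Λ^-½ X) * poissonObjective A ≤ stochasticObjective A)))
theorem2 ℝ =
  (λ X A → monotone⇒poisson≤stochastic ℝ A) ,
  -- The constant is the factor two in the relative loss `x`.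
  1# + 1# , <-≤-trans 0<1 (x≤x+y 0≤1) ,
  (λ X α 0<α A → approximatelyMonotone⇒poisson≤stochastic ℝ A (<⇒≤ 0<α))
  where
  open Reals ℝ
  open RealProperties ℝ
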